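{- Let $N\ge1$ and $b\ge1$ be integers, let $\Delta\ge 1$ and $K\ge 1$ be reals, and suppose $b\le\log_2(N/(K\Delta))$. Then there is a set $\mathcal{Y}\subset(\{0,1\}^b)^N$ of entropy deficiency at most $\Delta$ and min-entropy rate more than $1-1/b$ such that for every $I\subseteq[N]$ with $|I|\le (K-1)\Delta$, the set $\mathrm{IP}_b^{[N]\setminus I}((\{0,1\}^b)^N,\mathcal{Y})$ does not contain the all-$1$ string.
   Context: The Inner-Product function $\mathrm{IP}_b:\{0,1\}^b\times\{0,1\}^b\to\{0,1\}$ is $\mathrm{IP}_b(x,y)=\sum_j x_jy_j \bmod 2$. For $\mathcal{A},\mathcal{B}\subseteq(\{0,1\}^b)^N$ and $J\subseteq[N]$, $\mathrm{IP}_b^J(\mathcal{A},\mathcal{B})\subseteq\{0,1\}^J$ is the set of vectors $(\mathrm{IP}_b(x_i,y_i))_{i\in J}$ with $x\in\mathcal{A}$, $y\in\mathcal{B}$. A set is identified with the uniform distribution on it. The entropy deficiency of a set $\mathcal{Y}\subseteq(\{0,1\}^b)^N$ is $bN-\log_2|\mathcal{Y}|$. The min-entropy rate of a distribution $\mathcal{D}$ on $U^N$ is the largest $\tau$ such that for every $J\subseteq[N]$ and $\alpha_J\in U^J$, $\Pr_{x\sim\mathcal{D}}[x_J=\alpha_J]\le|U|^{ -\tau|J|}$ (here $|U|=2^b$). -}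

module Defs where

open import Algebra.Definitions.RawSemiring using () renaming (_^_ to power)
open import Data.Empty.Irrelevant using (⊥-elim)
open import Data.Fin using (Fin; toℕ)
open import Data.Fin.Properties using (all?) renaming (_≟_ to _≟ᶠ_)
open import Data.Fin.Subset using (Subset; _∈_; ∣_∣)
open import Data.Fin.Subset.Properties using (_∈?_)
open import Data.Integer using (ℤ; +_; -[1+_])
open import Data.List using (List; length; filter)
import Data.List.Membership.Propositional as List
open import Data.List.Relation.Unary.Unique.Propositional using (Unique)
open import Data.Nat as ℕ using (ℕ; suc; NonZero)
open import Data.Nat.DivMod using (_mod_)
open import Data.Nat.Properties using (m^n≢0)
open import Data.Product using (∃; ∃-syntax; _×_)
open import Data.Rational as ℚ using (ℚ; 0ℚ; 1ℚ; ↥_; ↧ₙ_; +-*-rawSemiring)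
open import Data.Sum using (_⊎_)
open import Data.Vec using (Vec; lookup; zipWith; sum)
open import Data.Vec.Properties using (≡-dec)
open import Level using (0ℓ)
open import Relation.Binary.PropositionalEquality using (_≡_)
open import Relation.Nullary using (¬_; Dec; yes; no)
open import Relation.Unary using (Pred)

-- Real numbers are Dedekind cuts of ℚ satisfying IsReal.  The operations
-- below are given on bare pairs of predicates, so that partial operations
-- need no side conditions; each returns the two halves of the Dedekind cut of
-- the intended real whenever its arguments are reals in its domain
-- (recip : x > 0; log₂ : x > 0; u ^ x : u ≥ 1).
record Cut : Set₁ where
  field
    lower : ℚ → Set
    upper : ℚ → Set

open Cut public

record IsReal (x : Cut) : Set where
  field
    lower-inhabited : ∃ (lower x)
    upper-inhabited : ∃ (upper x)
    lower-closed    : ∀ {p q} → p ℚ.< q → lower x q → lower x p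
    upper-closed    : ∀ {p q} → p ℚ.< q → upper x p → upper x q
    lower-rounded   : ∀ {p} → lower x p → ∃[ q ] p ℚ.< q × lower x q
    upper-rounded   : ∀ {q} → upper x q → ∃[ p ] p ℚ.< q × upper x p
    disjoint        : ∀ {q} → ¬ (lower x q × upper x q)
    located         : ∀ {p q} → p ℚ.< q → lower x p ⊎ upper x q

record ℝ : Set₁ where
  constructor mkℝ
  field
    cut    : Cut
    isReal : IsReal cut

open ℝ public

infix  4 _≤_ _<_
infixl 6 _+_ _-_
infixl 7 _*_ _/_
infixr 8 _^_
infix  9 -_

_≤_ : Cut → Cut → Set
x ≤ y = ∀ q → lower x q → lower y q

_<_ : Cut → Cut → Set
x < y = ∃[ q ] upper x q × lower y q

fromℚ : ℚ → Cut
fromℚ p = record { lower = ℚ._< p ; upper = p ℚ.<_ }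

fromℕ : ℕ → Cut
fromℕ n = fromℚ (+ n ℚ./ 1)

_+_ : Cut → Cut → Cut
x + y = record
  { lower = λ q → ∃[ a ] ∃[ b ] lower x a × lower y b × q ≡ a ℚ.+ b
  ; upper = λ q → ∃[ a ] ∃[ b ] upper x a × upper y b × q ≡ a ℚ.+ b
  }

-_ : Cut → Cut
- x = record
  { lower = λ q → upper x (ℚ.- q)
  ; upper = λ q → lower x (ℚ.- q)
  }

_-_ : Cut → Cut → Cut
x - y = x + - y

-- Interval multiplication: for a < x < b and c < y < d, the product xy lies
-- strictly between the minimum and the maximum of ac, ad, bc, bd.
_*_ : Cut → Cut → Cut
x * y = record
  { lower = λ q → ∃[ a ] ∃[ b ] ∃[ c ] ∃[ d ]
      (lower x a × upper x b × lower y c × upper y d) ×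
      (q ℚ.< a ℚ.* c × q ℚ.< a ℚ.* d × q ℚ.< b ℚ.* c × q ℚ.< b ℚ.* d)
  ; upper = λ q → ∃[ a ] ∃[ b ] ∃[ c ] ∃[ d ]
      (lower x a × upper x b × lower y c × upper y d) ×
      (a ℚ.* c ℚ.< q × a ℚ.* d ℚ.< q × b ℚ.* c ℚ.< q × b ℚ.* d ℚ.< q)
  }

recip : Cut → Cut
recip x = record
  { lower = λ q → ∃[ b ] upper x b × q ℚ.* b ℚ.< 1ℚ
  ; upper = λ q → ∃[ a ] lower x a × 0ℚ ℚ.< a × 1ℚ ℚ.< q ℚ.* a
  }

_/_ : Cut → Cut → Cut
x / y = x * recip y

infixr 8 _^ℚ_ _^ℤ_

_^ℚ_ : ℚ → ℕ → ℚ
_^ℚ_ = power +-*-rawSemiring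

_^ℤ_ : (u : ℕ) .{{_ : NonZero u}} → ℤ → ℚ
u ^ℤ (+ k)    = (+ u ℚ./ 1) ^ℚ k
u ^ℤ -[1+ k ] = (+ 1 ℚ./ u) ^ℚ suc k

-- a < u ^ r and u ^ r < a for rational r = p / n: as n ≥ 1 and u ^ r > 0,
-- both sides may be raised to the n-th power when a is positive.
BelowPower AbovePower : (u : ℕ) .{{_ : NonZero u}} → ℚ → ℚ → Set
BelowPower u r a = a ℚ.≤ 0ℚ ⊎ a ^ℚ (↧ₙ r) ℚ.< u ^ℤ (↥ r)
AbovePower u r a = 0ℚ ℚ.< a × u ^ℤ (↥ r) ℚ.< a ^ℚ (↧ₙ r)

_^_ : (u : ℕ) .{{_ : NonZero u}} → Cut → Cut
u ^ x = record
  { lower = λ a → ∃[ r ] lower x r × BelowPower u r a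
  ; upper = λ a → ∃[ r ] upper x r × AbovePower u r a
  }

-- r < log₂ x means 2 ^ r < x, and log₂ x < r means x < 2 ^ r.  For x ≤ 0 the
-- lower half is empty, i.e. log₂ x behaves as -∞.
log₂ : Cut → Cut
log₂ x = record
  { lower = λ r → ∃[ a ] lower x a × AbovePower 2 r a
  ; upper = λ r → ∃[ a ] upper x a × BelowPower 2 r a
  }

-- Nonempty, since a set is identified with the uniform distribution on it.
record FinSet⁺ (A : Set) : Set where
  field
    elements : List A
    unique   : Unique elements
    nonEmpty : NonZero (length elements)

  size : ℕ
  size = length elements

open FinSet⁺ public

_∈ˢ_ : {A : Set} → A → FinSet⁺ A → Set
x ∈ˢ Y = x List.∈ elements Y

Pr : {A : Set} (Y : FinSet⁺ A) {P : Pred A 0ℓ} → (∀ x → Dec (P x)) → ℚ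
Pr Y P? = ℚ._/_ (+ length (filter P? (elements Y))) (size Y) {{nonEmpty Y}}

-- A^J for J ⊆ [N]; vectors in it are compared pointwise by _≈_.
_^ˢ_ : {N : ℕ} → Set → Subset N → Set
_^ˢ_ {N} A J = (i : Fin N) → .(i ∈ J) → A

_≈_ : {N : ℕ} {A : Set} {J : Subset N} → A ^ˢ J → A ^ˢ J → Set
_≈_ {N} {J = J} α β = (i : Fin N) .(i∈J : i ∈ J) → α i i∈J ≡ β i i∈J

restrict : {N : ℕ} {A : Set} → Vec A N → (J : Subset N) → A ^ˢ J
restrict x J i _ = lookup x i

Bit : Set
Bit = Fin 2

Block : ℕ → Set
Block b = Vec Bit b

IP : {b : ℕ} → Block b → Block b → Bit
IP x y = sum (zipWith (λ s t → toℕ s ℕ.* toℕ t) x y) mod 2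

IP^ : {N b : ℕ} (J : Subset N) (𝒜 ℬ : Pred (Vec (Block b) N) 0ℓ) → Pred (Bit ^ˢ J) 0ℓ
IP^ J 𝒜 ℬ z =
  ∃[ x ] ∃[ y ] 𝒜 x × ℬ y × (λ i _ → IP (lookup x i) (lookup y i)) ≈ z

entropyDeficiency : {N b : ℕ} → FinSet⁺ (Vec (Block b) N) → Cut
entropyDeficiency {N} {b} Y = fromℕ (b ℕ.* N) - log₂ (fromℕ (size Y))

agree? : {N b : ℕ} (J : Subset N) (α : Block b ^ˢ J) (x : Vec (Block b) N) →
         Dec (restrict x J ≈ α)
agree? J α x = all? λ i → at i (i ∈? J)
  where
  at : ∀ i → Dec (i ∈ J) → Dec (.(i∈J : i ∈ J) → lookup x i ≡ α i i∈J)
  at i (no i∉J)  = yes λ i∈J → ⊥-elim (i∉J i∈J)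
  at i (yes i∈J) with ≡-dec _≟ᶠ_ (lookup x i) (α i i∈J)
  ... | yes eq = yes λ _ → eq
  ... | no neq = no λ f → neq (f i∈J)

-- Pr[x_J = α] ≤ |U|^{-τ|J|} for all J and α, where |U| = 2^b
MinEntropyBound : {N b : ℕ} → FinSet⁺ (Vec (Block b) N) → ℝ → Set
MinEntropyBound {N} {b} Y τ =
  (J : Subset N) (α : Block b ^ˢ J) →
  fromℚ (Pr Y (agree? J α)) ≤ _^_ (2 ℕ.^ b) {{m^n≢0 2 b}} (- cut τ * fromℕ ∣ J ∣)

IsMinEntropyRate : {N b : ℕ} → FinSet⁺ (Vec (Block b) N) → ℝ → Set₁
IsMinEntropyRate Y τ =
  MinEntropyBound Y τ × (∀ τ′ → MinEntropyBound Y τ′ → cut τ′ ≤ cut τ)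

{-# OPTIONS --safe #-}
module Submission where

-- Write u = 2^b.  A block y_i admits an x_i with IP(x_i, y_i) = 1 unless y_i = 0,
-- so Y may be any set of vectors y with more than (K - 1)Δ zero blocks.  As KΔ ≤ N/u
-- and Δ ≥ 1, having at least m = ⌊N/u⌋ of them is enough, and the set Y of these y
-- contains more than half of all vectors, because the median of a binomial
-- distribution is at least the integer part of its mean.  Hence the deficiency of Y
-- is below 1 ≤ Δ, and Pr[y_J = α] < 2 u^(-|J|) ≤ u^(-(1 - 1/b)|J|) for J ≠ ∅.
-- The min-entropy rate is attained: it is - log_u Pr[y_J = α] / |J| for a pair (J, α)
-- maximising Pr[y_J = α]^(1/|J|), which is found by comparing rational powers.

-- The median bound rests on pairing: for N = m u, the count of words with m - 1 - i zero blocks is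
-- at most the count with m + i. The innermost pair, m - 1 against m, is a strict inequality coming
-- straight from the ratio of neighbouring binomial terms, and further out the lower counts fall off
-- at least as fast as the upper ones. The strictness of that single pair makes Y a strict majority,
-- which gives the strict factor below 2 and hence a rate strictly above 1 - 1/b, since 2 = u^(1/b).
-- The integer m absorbs the real hypotheses because |I| + 1 ≤ (K - 1)Δ + Δ = KΔ ≤ N/u. The main
-- obstacle is that the reals are cuts: inequalities between logarithms and roots have to be
-- witnessed by rationals. A statement such as p/d < log a is therefore kept as u^p < a^d, and every
-- chain of such statements is raised to a common power, after which only integer exponents of u are
-- compared. Strict inequalities are exploited by inserting rationals into the gaps they leave.

module Binomial where

  -- Binomial counts and their median.

  open import Data.Nat
  open import Data.Nat.Properties
  open import Data.Nat.Tactic.RingSolver using (solve-∀)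
  open import Relation.Binary.PropositionalEquality

  -- The number of words of length n over an alphabet of w + 1 letters in which
  -- a fixed letter occurs exactly k times, respectively at least k times.
  exactly atLeast : ℕ → ℕ → ℕ → ℕ
  exactly w zero    zero    = 1
  exactly w zero    (suc k) = 0
  exactly w (suc n) zero    = w * exactly w n 0
  exactly w (suc n) (suc k) = exactly w n k + w * exactly w n (suc k)

  atLeast w zero    zero    = 1
  atLeast w zero    (suc k) = 0
  atLeast w (suc n) k       = atLeast w n (pred k) + w * atLeast w n k

  below : ℕ → ℕ → ℕ → ℕ
  below w n zero    = 0
  below w n (suc k) = below w n k + exactly w n k

  atLeast-suc : ∀ w n k → atLeast w n k ≡ exactly w n k + atLeast w n (suc k)
  atLeast-suc w zero    zero    = refl
  atLeast-suc w zero    (suc k) = refl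
  atLeast-suc w (suc n) zero    =
    trans (cong (λ t → atLeast w n 0 + w * t) (atLeast-suc w n 0))
          (lemma (atLeast w n 0) w (exactly w n 0) (atLeast w n 1))
    where
    lemma : ∀ t w e s → t + w * (e + s) ≡ w * e + (t + w * s)
    lemma = solve-∀
  atLeast-suc w (suc n) (suc k) =
    trans (cong₂ (λ s t → s + w * t) (atLeast-suc w n k) (atLeast-suc w n (suc k)))
          (lemma w (exactly w n k) (exactly w n (suc k)) (atLeast w n (suc k)) (atLeast w n (suc (suc k))))
    where
    lemma : ∀ w c d s t → c + s + w * (d + t) ≡ c + w * d + (s + w * t)
    lemma = solve-∀

  atLeast-zero : ∀ w n → atLeast w n 0 ≡ suc w ^ n
  atLeast-zero w zero    = refl
  atLeast-zero w (suc n) = cong₂ (λ s t → s + w * t) (atLeast-zero w n) (atLeast-zero w n)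

  below+atLeast : ∀ w n k → below w n k + atLeast w n k ≡ suc w ^ n
  below+atLeast w n zero    = atLeast-zero w n
  below+atLeast w n (suc k) = trans (+-assoc (below w n k) _ _)
    (trans (cong (below w n k +_) (sym (atLeast-suc w n k))) (below+atLeast w n k))

  -- With `suc v` other letters there is at least one to fill the remaining n - k places.
  exactly>0 : ∀ v n k → k ≤ n → 0 < exactly (suc v) n k
  exactly>0 v zero    zero    _         = s≤s z≤n
  exactly>0 v (suc n) zero    _         = ≤-trans (exactly>0 v n 0 z≤n) (m≤m+n _ _)
  exactly>0 v (suc n) (suc k) (s≤s k≤n) = ≤-trans (exactly>0 v n k k≤n) (m≤m+n _ _)

  -- C(n,k+1) / C(n,k) = (n - k) / (k + 1), with the subtraction moved across.
  exactly-ratio : ∀ w n k →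
    suc k * w * exactly w n (suc k) + k * exactly w n k ≡ n * exactly w n k
  exactly-ratio w zero    zero    = trans (+-identityʳ _) (*-zeroʳ (1 * w))
  exactly-ratio w zero    (suc k) = cong₂ _+_ (*-zeroʳ (suc (suc k) * w)) (*-zeroʳ (suc k))
  exactly-ratio w (suc n) zero    =
    trans (lemma₁ w (exactly w n 0) (exactly w n 1))
    (trans (cong (λ t → w * exactly w n 0 + w * t) (exactly-ratio w n 0))
           (lemma₂ w n (exactly w n 0)))
    where
    lemma₁ : ∀ w c d → 1 * w * (c + w * d) + 0 ≡ w * c + w * (1 * w * d + 0)
    lemma₁ = solve-∀
    lemma₂ : ∀ w n c → w * c + w * (n * c) ≡ suc n * (w * c)
    lemma₂ = solve-∀
  exactly-ratio w (suc n) (suc k) =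
    trans (lemma₁ w k C A B)
    (trans (cong₂ (λ s t → w * s + t + (w * A + C)) (exactly-ratio w n (suc k)) (exactly-ratio w n k))
           (lemma₂ w n A C))
    where
    C = exactly w n k
    A = exactly w n (suc k)
    B = exactly w n (suc (suc k))
    lemma₁ : ∀ w k c a b →
      suc (suc k) * w * (a + w * b) + suc k * (c + w * a) ≡
      w * (suc (suc k) * w * b + suc k * a) + (suc k * w * a + k * c) + (w * a + c)
    lemma₁ = solve-∀
    lemma₂ : ∀ w n a c → w * (n * a) + n * c + (w * a + c) ≡ suc n * (c + w * a)
    lemma₂ = solve-∀

  module _ (v : ℕ) where
    private
      w = suc v

      P : ℕ → ℕ → ℕ
      P m k = exactly w (m * suc w) k

    -- For n = m (w + 1) the mean is m, and the probabilities of m + i and of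
    -- m - 1 - i occurrences are compared by induction on i.
    ratio-below : ∀ e i → let m = suc (e + i) in
      suc e * w * P m (suc e) ≡ (m * w + suc i) * P m e
    ratio-below e i = +-cancelʳ-≡ (e * P m e) _ _
      (trans (exactly-ratio w (m * suc w) e) (lemma e i w (P m e)))
      where
      m = suc (e + i)
      lemma : ∀ e i w c → suc (e + i) * suc w * c ≡ (suc (e + i) * w + suc i) * c + e * c
      lemma = solve-∀

    -- The factor `suc e * w + suc i * v + 1` is n - (m + i) = m w - i for n = m (w + 1), written
    -- without subtraction by means of w = v + 1.
    ratio-above : ∀ e i → let m = suc (e + suc i) in
      (m + suc i) * w * P m (m + suc i) ≡ (suc e * w + suc i * v + 1) * P m (m + i)
    ratio-above e i = trans (cong (λ k → k * w * P m k) (+-suc m i))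
      (+-cancelʳ-≡ ((m + i) * P m (m + i)) _ _
      (trans (exactly-ratio w (m * suc w) (m + i)) (lemma e i v (P m (m + i)))))
      where
      m = suc (e + suc i)
      lemma : ∀ e i v c → suc (e + suc i) * suc (suc v) * c ≡
        (suc e * suc v + suc i * v + 1) * c + (suc (e + suc i) + i) * c
      lemma = solve-∀

    -- For the innermost pair the ratio of the two counts is (m w + 1) / (m w), which exceeds 1; the
    -- smaller count is positive, so the inequality is strict.
    exactly-mirror-< : ∀ e → let m = suc (e + 0) in P m e < P m (m + 0)
    exactly-mirror-< e = *-cancelˡ-< (m * w) _ _
      (subst (m * w * P m e <_) (sym eq) (m<n+m _ (exactly>0 v (m * suc w) e e≤n)))
      where
      m = suc (e + 0)
      e≤n : e ≤ m * suc w
      e≤n = ≤-trans (≤-trans (m≤m+n e 0) (n≤1+n _)) (m≤m*n m (suc w))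
      lemma : ∀ a c → (a + 1) * c ≡ c + a * c
      lemma = solve-∀
      eq : m * w * P m (m + 0) ≡ P m e + m * w * P m e
      eq = trans (cong (λ k → m * w * P m k) (+-identityʳ m))
           (trans (cong (λ k → suc k * w * P m (suc k)) (+-identityʳ e))
           (trans (ratio-below e 0) (lemma (m * w) (P m e))))

    -- Induction from the inner pair to the next outer one with `m` fixed. It suffices that the
    -- lower count shrinks by at least as large a factor as the upper one; after cross
    -- multiplication this is an inequality of polynomials.
    exactly-mirror : ∀ e i → let m = suc (e + i) in P m e ≤ P m (m + i)
    exactly-mirror e zero    = <⇒≤ (exactly-mirror-< e)
    exactly-mirror e (suc i) = *-cancelˡ-≤ ((m + suc i) * w * (suc e * w)) (begin
      (m + suc i) * w * (suc e * w) * P m e           ≤⟨ *-monoˡ-≤ (P m e)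
                                                           (m≤m+n ((m + suc i) * w * (suc e * w)) slack) ⟩
      ((m + suc i) * w * (suc e * w) + slack) * P m e ≡⟨ cong (_* P m e) (lemma e i v) ⟨
      s * (m * w + suc (suc i)) * P m e               ≡⟨ *-assoc s (m * w + suc (suc i)) (P m e) ⟩
      s * ((m * w + suc (suc i)) * P m e)             ≡⟨ cong (s *_) (ratio-below e (suc i)) ⟨
      s * (suc e * w * P m (suc e))                   ≤⟨ *-monoʳ-≤ s (*-monoʳ-≤ (suc e * w) IH) ⟩
      s * (suc e * w * P m (m + i))                   ≡⟨ lemma′ s (suc e * w) (P m (m + i)) ⟩
      suc e * w * (s * P m (m + i))                   ≡⟨ cong (suc e * w *_) (ratio-above e i) ⟨
      suc e * w * ((m + suc i) * w * P m (m + suc i)) ≡⟨ lemma″ (suc e * w) ((m + suc i) * w) _ ⟩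
      (m + suc i) * w * (suc e * w) * P m (m + suc i) ∎)
      where
      open ≤-Reasoning
      m = suc (e + suc i)
      s = suc e * w + suc i * v + 1
      -- The difference of the two cross products of the ratios. All its coefficients in `e`, `i`,
      -- `v` are nonnegative once `m` is expanded as e + i + 2.
      slack = 2 * (suc e * w) + (suc i * v + 1) * (suc i * w + 1 + suc i)
      IH : P m (suc e) ≤ P m (m + i)
      IH = subst (λ m′ → P (suc m′) (suc e) ≤ P (suc m′) (suc m′ + i))
                 (sym (+-suc e i)) (exactly-mirror (suc e) i)
      lemma : ∀ e i v → (suc e * suc v + suc i * v + 1) * (suc (e + suc i) * suc v + suc (suc i)) ≡
        (suc (e + suc i) + suc i) * suc v * (suc e * suc v) +
        (2 * (suc e * suc v) + (suc i * v + 1) * (suc i * suc v + 1 + suc i))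
      lemma = solve-∀
      lemma′ : ∀ s t c → s * (t * c) ≡ t * (s * c)
      lemma′ = solve-∀
      lemma″ : ∀ s t c → s * (t * c) ≡ t * s * c
      lemma″ = solve-∀

    -- Sums the mirrored inequalities: each number of occurrences below `e` is matched with its
    -- reflection, which is at least m + i.
    below≤atLeast : ∀ e i m → e + i ≡ m →
      below w (m * suc w) e ≤ atLeast w (m * suc w) (m + i)
    below≤atLeast zero    i m _    = z≤n
    below≤atLeast (suc e) i m refl = begin
      below w n e + P m e                   ≤⟨ +-mono-≤ (below≤atLeast e (suc i) m (+-suc e i))
                                                         (exactly-mirror e i) ⟩
      atLeast w n (m + suc i) + P m (m + i) ≡⟨ cong (λ k → atLeast w n k + P m (m + i)) (+-suc m i) ⟩
      atLeast w n (suc (m + i)) + P m (m + i) ≡⟨ +-comm _ (P m (m + i)) ⟩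
      P m (m + i) + atLeast w n (suc (m + i)) ≡⟨ atLeast-suc w n (m + i) ⟨
      atLeast w n (m + i)                   ∎
      where
      open ≤-Reasoning
      n = m * suc w

    -- The pair m - 1, m contributes the strict inequality; all other pairs contribute weak ones.
    below<atLeast : ∀ m → below w (m * suc w) m < atLeast w (m * suc w) m
    below<atLeast zero    = s≤s z≤n
    below<atLeast (suc e) = begin-strict
      below w n e + P m e                <⟨ +-mono-≤-< (below≤atLeast e 1 m (+-comm e 1)) P<P ⟩
      atLeast w n (m + 1) + P m m        ≡⟨ +-comm _ (P m m) ⟩
      P m m + atLeast w n (m + 1)        ≡⟨ cong (λ k → P m m + atLeast w n k) (+-comm m 1) ⟩
      P m m + atLeast w n (suc m)        ≡⟨ atLeast-suc w n m ⟨
      atLeast w n m                      ∎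
      where
      open ≤-Reasoning
      m = suc e
      n = m * suc w
      P<P : P m e < P m m
      P<P = subst (λ k → P (suc k) e < P (suc k) m) (+-identityʳ e)
               (subst (λ k → P (suc (e + 0)) e < P (suc (e + 0)) k)
                      (trans (+-identityʳ _) (cong suc (+-identityʳ e))) (exactly-mirror-< e))

    atLeast-step : ∀ n k → suc w * atLeast w n k ≤ atLeast w (suc n) k
    atLeast-step n zero    = ≤-refl
    atLeast-step n (suc k) = +-monoˡ-≤ (w * atLeast w n (suc k))
      (≤-trans (m≤n+m _ (exactly w n k)) (≤-reflexive (sym (atLeast-suc w n k))))

    -- For d = 0 the mean is m, so that this bounds the median from below; a longer
    -- word has at least as many occurrences.
    atLeast-mean : ∀ m d → suc w ^ (d + m * suc w) < 2 * atLeast w (d + m * suc w) m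
    atLeast-mean m zero    = begin-strict
      suc w ^ n                       ≡⟨ below+atLeast w n m ⟨
      below w n m + atLeast w n m     <⟨ +-monoˡ-< (atLeast w n m) (below<atLeast m) ⟩
      atLeast w n m + atLeast w n m   ≡⟨ cong (atLeast w n m +_) (+-identityʳ _) ⟨
      2 * atLeast w n m               ∎
      where
      open ≤-Reasoning
      n = m * suc w
    atLeast-mean m (suc d) = begin-strict
      suc w * suc w ^ (d + m * suc w)             <⟨ *-monoʳ-< (suc w) (atLeast-mean m d) ⟩
      suc w * (2 * atLeast w (d + m * suc w) m)   ≡⟨ lemma (suc w) (atLeast w (d + m * suc w) m) ⟩
      2 * (suc w * atLeast w (d + m * suc w) m)   ≤⟨ *-monoʳ-≤ 2 (atLeast-step (d + m * suc w) m) ⟩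
      2 * atLeast w (suc d + m * suc w) m         ∎
      where
      open ≤-Reasoning
      lemma : ∀ s t → s * (2 * t) ≡ 2 * (s * t)
      lemma = solve-∀

-- Vectors with many zero blocks: enumeration, counting and the pigeonhole argument.

module Words where

  open Binomial
  open import Defs using (Bit; Block; IP; _^ˢ_; _≈_; restrict; agree?)
  open import Data.Empty using (⊥-elim)
  open import Data.Fin using (zero; suc; toℕ)
  open import Data.Fin.Subset using (Subset; inside; outside; ∣_∣; ∁) renaming (_∈_ to _∈ₛ_)
  open import Data.List using (List; []; _∷_; _++_; map; length; cartesianProductWith; filter)
  open import Data.List.Membership.Propositional using (_∈_)
  open import Data.List.Membership.Propositional.Properties
  open import Data.List.Properties using (length-map; length-++)
  open import Data.List.Relation.Binary.Subset.Propositional using (_⊆_)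
  import Data.List.Relation.Unary.All as All
  open import Data.List.Relation.Unary.AllPairs using ([]; _∷_)
  open import Data.List.Relation.Unary.Any using (here; there)
  open import Data.List.Relation.Unary.Unique.Propositional using (Unique)
  import Data.List.Relation.Unary.Unique.Propositional.Properties as Unique
  open import Data.Nat
  open import Data.Nat.DivMod using (_mod_; m≡m%n+[m/n]*n)
  open import Data.Nat.Properties
  open import Data.Nat.Tactic.RingSolver using (solve-∀)
  open import Data.Product using (∃-syntax; _×_; _,_; proj₂)
  open import Data.Sum using (inj₁; inj₂)
  open import Data.Vec as Vec using (Vec; []; _∷_; here; there; lookup)
  import Data.Vec.Properties as Vec
  open import Function using (_⟨_⟩_)
  open import Relation.Binary.PropositionalEquality
  open import Relation.Nullary using (¬_)

  length-⊆ : {A : Set} {xs ys : List A} → Unique xs → xs ⊆ ys → length xs ≤ length ys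
  length-⊆ {xs = []}     _            _ = z≤n
  length-⊆ {xs = x ∷ xs} (x∉xs ∷ uxs) sub with ∈-∃++ (sub (here refl))
  ... | as , bs , refl = begin
    suc (length xs)              ≤⟨ s≤s (length-⊆ uxs sub′) ⟩
    suc (length (as ++ bs))      ≡⟨ cong suc (length-++ as) ⟩
    suc (length as + length bs)  ≡⟨ +-suc (length as) (length bs) ⟨
    length as + suc (length bs)  ≡⟨ length-++ as ⟨
    length (as ++ x ∷ bs)        ∎
    where
    open ≤-Reasoning
    sub′ : xs ⊆ as ++ bs
    sub′ z∈xs with ∈-++⁻ as (sub (there z∈xs))
    ... | inj₁ z∈as         = ∈-++⁺ˡ z∈as
    ... | inj₂ (here refl)  = ⊥-elim (All.lookup x∉xs z∈xs refl)
    ... | inj₂ (there z∈bs) = ∈-++⁺ʳ as z∈bs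

  length-cartesianProductWith : {A B C : Set} (f : A → B → C) (xs : List A) (ys : List B) →
    length (cartesianProductWith f xs ys) ≡ length xs * length ys
  length-cartesianProductWith f []       ys = refl
  length-cartesianProductWith f (x ∷ xs) ys = trans (length-++ (map (f x) ys))
    (cong₂ _+_ (length-map (f x) ys) (length-cartesianProductWith f xs ys))

  zeroBlock : ∀ b → Block b
  zeroBlock b = Vec.replicate b zero

  -- The zero block is kept apart at the head: it is the distinguished letter of `exactly` and
  -- `atLeast`, and the nonzero blocks are the other w letters.
  nonzeroBlocks blocks : ∀ b → List (Block b)
  blocks b = zeroBlock b ∷ nonzeroBlocks b
  nonzeroBlocks zero    = []
  nonzeroBlocks (suc b) =
    map (zero ∷_) (nonzeroBlocks b) ++ map (suc zero ∷_) (zeroBlock b ∷ nonzeroBlocks b)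

  length-blocks : ∀ b → length (blocks b) ≡ 2 ^ b
  length-blocks zero    = refl
  length-blocks (suc b) = cong suc (begin
    length (map (zero ∷_) nz ++ map (suc zero ∷_) (blocks b))
      ≡⟨ length-++ (map (zero ∷_) nz) ⟩
    length (map (Vec._∷_ {A = Bit} zero) nz) + length (map (Vec._∷_ {A = Bit} (suc zero)) (blocks b))
      ≡⟨ cong₂ _+_ (length-map _ nz) (length-map _ (blocks b)) ⟩
    length nz + length (blocks b)  ≡⟨ cong (length nz +_) (+-identityʳ _) ⟨
    length nz + (length (blocks b) + 0) ∎)
    ⟨ trans ⟩ cong (2 *_) (length-blocks b)
    where
    open ≡-Reasoning
    nz = nonzeroBlocks b

  ∈-blocks : ∀ {b} (x : Block b) → x ∈ blocks b
  ∈-blocks []                = here refl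
  ∈-blocks (zero ∷ x) with ∈-blocks x
  ... | here refl  = here refl
  ... | there x∈nz = there (∈-++⁺ˡ (∈-map⁺ _ x∈nz))
  ∈-blocks (suc zero ∷ x) = there (∈-++⁺ʳ _ (∈-map⁺ _ (∈-blocks x)))

  blocks-unique : ∀ b → Unique (blocks b)
  blocks-unique zero    = All.[] ∷ []
  blocks-unique (suc b) with blocks-unique b
  ... | 0∉nz ∷ unz = All.tabulate 0∉ ∷
    Unique.++⁺ (Unique.map⁺ Vec.∷-injectiveʳ unz) (Unique.map⁺ Vec.∷-injectiveʳ (blocks-unique b)) disjoint′
    where
    0∉ : ∀ {x} → x ∈ nonzeroBlocks (suc b) → zeroBlock (suc b) ≢ x
    0∉ x∈ eq with ∈-++⁻ (map (zero ∷_) (nonzeroBlocks b)) x∈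
    0∉ x∈ refl | inj₁ x∈₁ with ∈-map⁻ _ x∈₁
    ... | _ , y∈ , refl = All.lookup 0∉nz y∈ refl
    0∉ x∈ refl | inj₂ x∈₂ with ∈-map⁻ _ x∈₂
    ... | _ , _ , ()
    disjoint′ : ∀ {x} → ¬ (x ∈ map (zero ∷_) (nonzeroBlocks b) × x ∈ map (suc zero ∷_) (blocks b))
    disjoint′ (x∈₁ , x∈₂) with ∈-map⁻ _ x∈₁ | ∈-map⁻ _ x∈₂
    ... | _ , _ , refl | _ , _ , ()

  words : ∀ b (n k : ℕ) → List (Vec (Block b) n)
  words b zero    zero    = [] ∷ []
  words b zero    (suc k) = []
  words b (suc n) k       =
    map (zeroBlock b ∷_) (words b n (pred k)) ++
    cartesianProductWith _∷_ (nonzeroBlocks b) (words b n k)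

  length-words : ∀ b n k → length (words b n k) ≡ atLeast (length (nonzeroBlocks b)) n k
  length-words b zero    zero    = refl
  length-words b zero    (suc k) = refl
  length-words b (suc n) k       = trans (length-++ (map _ (words b n (pred k))))
    (cong₂ _+_ (trans (length-map _ (words b n (pred k))) (length-words b n (pred k)))
               (trans (length-cartesianProductWith _∷_ (nonzeroBlocks b) (words b n k))
                      (cong (length (nonzeroBlocks b) *_) (length-words b n k))))

  words-unique : ∀ b n k → Unique (words b n k)
  words-unique b zero    zero    = All.[] ∷ []
  words-unique b zero    (suc k) = []
  words-unique b (suc n) k with blocks-unique b
  ... | 0∉nz ∷ unz = Unique.++⁺
    (Unique.map⁺ Vec.∷-injectiveʳ (words-unique b n (pred k)))
    (Unique.cartesianProductWith⁺ _∷_ Vec.∷-injective unz (words-unique b n k))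
    disjoint′
    where
    disjoint′ : ∀ {x} → ¬ (x ∈ map (zeroBlock b ∷_) (words b n (pred k)) ×
                           x ∈ cartesianProductWith _∷_ (nonzeroBlocks b) (words b n k))
    disjoint′ (x∈₁ , x∈₂)
      with ∈-map⁻ _ x∈₁ | ∈-cartesianProductWith⁻ _∷_ (nonzeroBlocks b) (words b n k) x∈₂
    ... | _ , _ , refl | _ , _ , c∈ , _ , refl = All.lookup 0∉nz c∈ refl

  -- Pigeonhole by recursion on the coordinates: a zero block at the head either lies outside `I`
  -- and is the witness, or it uses up one element of `I` together with one of the `k` required zero
  -- blocks.
  zero-outside : ∀ {b} n k (y : Vec (Block b) n) → y ∈ words b n k → (I : Subset n) → ∣ I ∣ < k →
    ∃[ i ] i ∈ₛ ∁ I × lookup y i ≡ zeroBlock b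
  zero-outside zero    zero    y y∈ I ()
  zero-outside zero    (suc k) y () I _
  zero-outside (suc n) k y y∈ I I<k with ∈-++⁻ (map _ (words _ n (pred k))) y∈
  zero-outside (suc n) k y y∈ (outside ∷ I) I<k | inj₁ y∈₁ with ∈-map⁻ _ y∈₁
  ... | y′ , _ , refl = zero , here , refl
  zero-outside (suc n) (suc k) y y∈ (inside ∷ I) (s≤s I<k) | inj₁ y∈₁ with ∈-map⁻ _ y∈₁
  ... | y′ , y′∈ , refl with zero-outside n k y′ y′∈ I I<k
  ... | i , i∈ , eq = suc i , there i∈ , eq
  zero-outside {b} (suc n) k y y∈ (s ∷ I) I<k | inj₂ y∈₂
    with ∈-cartesianProductWith⁻ _∷_ (nonzeroBlocks b) (words b n k) y∈₂
  ... | _ , y′ , _ , y′∈ , refl with zero-outside n k y′ y′∈ I (≤-<-trans (∣I∣≤ s) I<k)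
    where
    ∣I∣≤ : ∀ s → ∣ I ∣ ≤ ∣ s ∷ I ∣
    ∣I∣≤ inside  = n≤1+n _
    ∣I∣≤ outside = ≤-refl
  ... | i , i∈ , eq = suc i , there i∈ , eq

  IP-zeroʳ : ∀ {b} (x : Block b) → IP x (zeroBlock b) ≡ zero
  IP-zeroʳ x = cong (_mod 2) (lemma x)
    where
    lemma : ∀ {b} (x : Block b) →
      Vec.sum (Vec.zipWith (λ s t → toℕ s * toℕ t) x (zeroBlock b)) ≡ 0
    lemma []      = refl
    lemma (s ∷ x) = cong₂ _+_ (*-zeroʳ (toℕ s)) (lemma x)


  -- Vectors with prescribed coordinates on J.

  tailˢ : ∀ {n s} {A : Set} {J : Subset n} → A ^ˢ (s ∷ J) → A ^ˢ J
  tailˢ α i i∈J = α (suc i) (there i∈J)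

  extensions : ∀ {b n} (J : Subset n) → Block b ^ˢ J → List (Vec (Block b) n)
  extensions     []            α = [] ∷ []
  extensions     (inside ∷ J)  α = map (α zero here ∷_) (extensions J (tailˢ α))
  extensions {b} (outside ∷ J) α =
    cartesianProductWith _∷_ (blocks b) (extensions J (tailˢ α))

  length-extensions : ∀ {b n} (J : Subset n) (α : Block b ^ˢ J) →
    length (extensions J α) * (2 ^ b) ^ ∣ J ∣ ≡ (2 ^ b) ^ n
  length-extensions     []           α = refl
  length-extensions {b} (inside ∷ J) α = trans
    (cong (_* (2 ^ b) ^ suc ∣ J ∣) (length-map _ (extensions J (tailˢ α))))
    (trans (lemma (length (extensions J (tailˢ α))) (2 ^ b) ((2 ^ b) ^ ∣ J ∣))
           (cong (2 ^ b *_) (length-extensions J (tailˢ α))))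
    where
    lemma : ∀ l u v → l * (u * v) ≡ u * (l * v)
    lemma = solve-∀
  length-extensions {b} (outside ∷ J) α = trans
    (cong (_* (2 ^ b) ^ ∣ J ∣) (trans (length-cartesianProductWith _∷_ (blocks b) (extensions J (tailˢ α)))
                                      (cong (_* length (extensions J (tailˢ α))) (length-blocks b))))
    (trans (*-assoc (2 ^ b) (length (extensions J (tailˢ α))) _)
           (cong (2 ^ b *_) (length-extensions J (tailˢ α))))

  ∈-extensions : ∀ {b n} (J : Subset n) (α : Block b ^ˢ J) x → restrict x J ≈ α → x ∈ extensions J α
  ∈-extensions []            α []      _  = here refl
  ∈-extensions (inside ∷ J)  α (c ∷ x) eq with eq zero here
  ... | refl = ∈-map⁺ _ (∈-extensions J _ x (λ i i∈J → eq (suc i) (there i∈J)))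
  ∈-extensions (outside ∷ J) α (c ∷ x) eq =
    ∈-cartesianProductWith⁺ _∷_ (∈-blocks c) (∈-extensions J _ x (λ i i∈J → eq (suc i) (there i∈J)))

  -- A duplicate-free list meets the set of extensions of `α` in at most as many points as the whole
  -- space does, namely u^(n - |J|); the power is multiplied across to avoid subtraction.
  agree-bound : ∀ {b n} (ys : List (Vec (Block b) n)) → Unique ys → (J : Subset n) (α : Block b ^ˢ J) →
    length (filter (agree? J α) ys) * (2 ^ b) ^ ∣ J ∣ ≤ (2 ^ b) ^ n
  agree-bound {b} ys uys J α = ≤-trans
    (*-monoˡ-≤ ((2 ^ b) ^ ∣ J ∣) (length-⊆ (Unique.filter⁺ (agree? J α) uys)
      λ {x} x∈ → ∈-extensions J α x (proj₂ (∈-filter⁻ (agree? J α) {xs = ys} x∈))))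
    (≤-reflexive (length-extensions J α))


  words-majority : ∀ b .{{_ : NonZero b}} N → let instance _ = m^n≢0 2 b in
    (2 ^ b) ^ N < 2 * length (words b N (N / 2 ^ b))
  words-majority b@(suc b-1) N = begin-strict
    (2 ^ b) ^ N                          ≡⟨ cong (_^ N) u≡ ⟩
    suc (suc v) ^ N                      ≡⟨ cong (suc (suc v) ^_) N≡ ⟩
    suc (suc v) ^ (N % 2 ^ b + m * suc (suc v)) <⟨ atLeast-mean v m (N % 2 ^ b) ⟩
    2 * atLeast (suc v) (N % 2 ^ b + m * suc (suc v)) m ≡⟨ cong (λ n → 2 * atLeast (suc v) n m) N≡ ⟨
    2 * atLeast (suc v) N m              ≡⟨ cong (λ w → 2 * atLeast w N m) w≡ ⟨
    2 * atLeast (length (nonzeroBlocks b)) N m ≡⟨ cong (λ l → 2 * l) (length-words b N m) ⟨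
    2 * length (words b N m)             ∎
    where
    open ≤-Reasoning
    instance _ = m^n≢0 2 b
    m = N / 2 ^ b
    -- This is 2^b - 2. Since b ≥ 1 there is at least one nonzero block, so the number of other
    -- letters has the form `suc v` that the median bound asks for.
    v = length (map (zero {1} ∷_) (nonzeroBlocks b-1)) + length (map (suc {1} zero ∷_) (nonzeroBlocks b-1))
    w≡ : length (nonzeroBlocks b) ≡ suc v
    w≡ = trans (length-++ (map (zero ∷_) (nonzeroBlocks b-1))) (+-suc _ _)
    u≡ : 2 ^ b ≡ suc (suc v)
    u≡ = trans (sym (length-blocks b)) (cong suc w≡)
    N≡ : N ≡ N % 2 ^ b + m * suc (suc v)
    N≡ = trans (m≡m%n+[m/n]*n N (2 ^ b)) (cong (λ u → N % 2 ^ b + m * u) u≡)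

-- Arithmetic of rationals, fractions and natural powers.

module Analysis where

  open Words
  open import Defs
    using (Cut; lower; upper; IsReal; ℝ; mkℝ; cut; isReal; fromℚ; fromℕ; recip; log₂
          ; _^ℚ_; _^ℤ_; BelowPower; AbovePower
          ; FinSet⁺; elements; size; nonEmpty; _∈ˢ_; Pr; _^ˢ_; _≈_; restrict; agree?
          ; Block; IP; IP^; entropyDeficiency; IsMinEntropyRate)
  import Defs as ℝ
  open import Algebra.Bundles using (CommutativeRing)
  import Algebra.Properties.CommutativeSemiring.Exp as CommutativeExp
  import Algebra.Properties.Semiring.Exp as Exp
  open import Data.Empty using (⊥; ⊥-elim)
  open import Data.Fin using (zero; suc)
  open import Data.Fin.Subset using (Subset; inside; outside; ∣_∣; ∁; ⊤) renaming (_∈_ to _∈ₛ_)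
  open import Data.Fin.Subset.Properties using (∣⊤∣≡n)
  open import Data.Integer as ℤ using (ℤ; +_; -[1+_])
  import Data.Integer.Properties as ℤ
  import Data.Integer.Tactic.RingSolver as ℤ-Solver
  open import Data.List using (List; []; _∷_; _++_; map; length; filter; cartesianProduct)
  open import Data.List.Membership.Propositional using (_∈_)
  open import Data.List.Membership.Propositional.Properties
  open import Data.List.Properties using (filter-≐; length-filter)
  open import Data.List.Relation.Unary.Any using (here; there)
  open import Data.List.Relation.Unary.Any.Properties using (¬Any[])
  open import Data.Nat as ℕ using (ℕ; zero; suc; z≤n; s≤s; NonZero)
  import Data.Nat.Coprimality as Coprime
  open import Data.Nat.DivMod using (/-monoˡ-≤; m*n/n≡m)
  import Data.Nat.Properties as ℕ
  import Data.Nat.Tactic.RingSolver as ℕ-Solver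
  open import Data.Product using (∃; ∃-syntax; _×_; _,_; proj₁; proj₂)
  open import Data.Rational as ℚ
    using (ℚ; mkℚ; 0ℚ; 1ℚ; ½; ↥_; ↧_; ↧ₙ_; _/_; 1/_; _+_; _-_; -_; _*_; _≤_; _<_; *≤*; *<*
          ; toℚᵘ; Positive; positive; nonNegative)
  open import Data.Rational.Properties
  import Data.Rational.Unnormalised as ℚᵘ
  import Data.Rational.Unnormalised.Properties as ℚᵘ
  open import Data.Sum using (_⊎_; inj₁; inj₂; [_,_]′)
  open import Data.Vec using (Vec; []; _∷_; lookup)
  open import Relation.Binary.Definitions using (Tri; tri<; tri≈; tri>)
  open import Relation.Binary.PropositionalEquality hiding (J)
  open import Relation.Nullary using (¬_; yes; no)
  open import Relation.Nullary.Decidable using (dec⇒maybe)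
  import Relation.Unary as Unary
  open import Tactic.RingSolver using (solve-∀)
  open import Tactic.RingSolver.Core.AlmostCommutativeRing
    using (AlmostCommutativeRing; fromCommutativeRing)

  ℚ-ring : AlmostCommutativeRing _ _
  ℚ-ring = fromCommutativeRing +-*-commutativeRing (λ x → dec⇒maybe (0ℚ ≟ x))

  module ^ℚ = Exp (CommutativeRing.semiring +-*-commutativeRing)

  ι : ℕ → ℚ
  ι n = + n / 1

  *-monoˡ-< : ∀ {a b c} → 0ℚ < c → a < b → c * a < c * b
  *-monoˡ-< {c = c} 0<c = *-monoʳ-<-pos c {{positive 0<c}}

  *-monoʳ-< : ∀ {a b c} → 0ℚ < c → a < b → a * c < b * c
  *-monoʳ-< {c = c} 0<c = *-monoˡ-<-pos c {{positive 0<c}}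

  *-monoˡ-≤ : ∀ {a b c} → 0ℚ ≤ c → a ≤ b → c * a ≤ c * b
  *-monoˡ-≤ {c = c} 0≤c = *-monoˡ-≤-nonNeg c {{nonNegative 0≤c}}

  *-monoʳ-≤ : ∀ {a b c} → 0ℚ ≤ c → a ≤ b → a * c ≤ b * c
  *-monoʳ-≤ {c = c} 0≤c = *-monoʳ-≤-nonNeg c {{nonNegative 0≤c}}

  *-cancelʳ-< : ∀ {a b c} → 0ℚ < c → a * c < b * c → a < b
  *-cancelʳ-< {c = c} 0<c = *-cancelʳ-<-nonNeg c {{nonNegative (<⇒≤ 0<c)}}

  *-pos : ∀ {a b} → 0ℚ < a → 0ℚ < b → 0ℚ < a * b
  *-pos {a} 0<a 0<b = subst (_< a * _) (*-zeroʳ a) (*-monoˡ-< 0<a 0<b)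

  *-nonNeg : ∀ {a b} → 0ℚ ≤ a → 0ℚ ≤ b → 0ℚ ≤ a * b
  *-nonNeg {a} 0≤a 0≤b = subst (_≤ a * _) (*-zeroʳ a) (*-monoˡ-≤ 0≤a 0≤b)

  0<1 : 0ℚ < 1ℚ
  0<1 = *<* (ℤ.+<+ (s≤s z≤n))

  p<q⇒0<q-p : ∀ {p q} → p < q → 0ℚ < q - p
  p<q⇒0<q-p {p} {q} p<q = subst (_< q - p) (+-inverseʳ p) (+-monoˡ-< (- p) p<q)

  p≤q⇒0≤q-p : ∀ {p q} → p ≤ q → 0ℚ ≤ q - p
  p≤q⇒0≤q-p {p} {q} p≤q = subst (_≤ q - p) (+-inverseʳ p) (+-monoˡ-≤ (- p) p≤q)

  0<q-p⇒p<q : ∀ {p q} → 0ℚ < q - p → p < q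
  0<q-p⇒p<q {p} {q} h = subst₂ _<_ (+-identityˡ p) (lemma q p) (+-monoˡ-< p h)
    where
    lemma : ∀ q p → (q - p) + p ≡ q
    lemma = solve-∀ ℚ-ring

  neg-involutive : ∀ p → - (- p) ≡ p
  neg-involutive = solve-∀ ℚ-ring

  inverse : ∀ {p} → 0ℚ < p → ∃[ r ] 0ℚ < r × r * p ≡ 1ℚ
  inverse {p} 0<p = 1/ p , positive⁻¹ (1/ p) {{1/pos⇒pos p}} , *-inverseˡ p
    where
    instance
      p>0 : Positive p
      p>0 = positive 0<p
      p≢0 : ℚ.NonZero p
      p≢0 = pos⇒nonZero p

  /-≃ : ∀ i c .{{_ : NonZero c}} → toℚᵘ (i / c) ℚᵘ.≃ i ℚᵘ./ c
  /-≃ i (suc c-1) = toℚᵘ-fromℚᵘ (ℚᵘ.mkℚᵘ i c-1)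

  /-≡ : ∀ i j c d .{{_ : NonZero c}} .{{_ : NonZero d}} → i ℤ.* + d ≡ j ℤ.* + c → i / c ≡ j / d
  /-≡ i j (suc c-1) (suc d-1) eq = fromℚᵘ-cong {ℚᵘ.mkℚᵘ i c-1} {ℚᵘ.mkℚᵘ j d-1} (ℚᵘ.*≡* eq)

  /-mono-< : ∀ i j c d .{{_ : NonZero c}} .{{_ : NonZero d}} →
    i ℤ.* + d ℤ.< j ℤ.* + c → i / c < j / d
  /-mono-< i j c@(suc _) d@(suc _) lt = toℚᵘ-cancel-<
    (ℚᵘ.<-respˡ-≃ (ℚᵘ.≃-sym (/-≃ i c)) (ℚᵘ.<-respʳ-≃ (ℚᵘ.≃-sym (/-≃ j d)) (ℚᵘ.*<* lt)))

  /-* : ∀ i j c d .{{_ : NonZero c}} .{{_ : NonZero d}} →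
    (i / c) * (j / d) ≡ _/_ (i ℤ.* j) (c ℕ.* d) {{ℕ.m*n≢0 c d}}
  /-* i j c@(suc _) d@(suc _) = toℚᵘ-injective (ℚᵘ.≃-trans (toℚᵘ-homo-* (i / c) (j / d))
    (ℚᵘ.≃-trans
      (ℚᵘ.*-cong {toℚᵘ (i / c)} {i ℚᵘ./ c} {toℚᵘ (j / d)} {j ℚᵘ./ d} (/-≃ i c) (/-≃ j d))
      (ℚᵘ.≃-sym (/-≃ (i ℤ.* j) (c ℕ.* d)))))

  /1≡mkℚ : ∀ i → i / 1 ≡ mkℚ i 0 (Coprime.sym (Coprime.1-coprimeTo ℤ.∣ i ∣))
  /1≡mkℚ i = ↥p/↧p≡p (mkℚ i 0 (Coprime.sym (Coprime.1-coprimeTo ℤ.∣ i ∣)))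

  /1-+ : ∀ i j → (i ℤ.+ j) / 1 ≡ i / 1 + j / 1
  /1-+ i j = sym (trans (cong₂ _+_ (/1≡mkℚ i) (/1≡mkℚ j))
    (/-cong (cong₂ ℤ._+_ (ℤ.*-identityʳ i) (ℤ.*-identityʳ j)) refl))

  *-ι : ∀ r n → r * ι n ≡ (↥ r ℤ.* + n) / ↧ₙ r
  *-ι r@(mkℚ p d-1 _) n = trans (cong (r *_) (/1≡mkℚ (+ n)))
    (/-cong {p ℤ.* + n} refl (ℕ.*-identityʳ (suc d-1)))

  *-ι-↧ : ∀ r → r * ι (↧ₙ r) ≡ ↥ r / 1
  *-ι-↧ r = trans (*-ι r (↧ₙ r)) (/-≡ (↥ r ℤ.* ↧ r) (↥ r) (↧ₙ r) 1 (ℤ.*-identityʳ (↥ r ℤ.* ↧ r)))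

  ι-+ : ∀ m n → ι (m ℕ.+ n) ≡ ι m + ι n
  ι-+ m n = /1-+ (+ m) (+ n)

  ι-* : ∀ m n → ι (m ℕ.* n) ≡ ι m * ι n
  ι-* m n = sym (trans (cong₂ _*_ (/1≡mkℚ (+ m)) (/1≡mkℚ (+ n))) (/-cong (sym (ℤ.pos-* m n)) refl))

  ι-^ : ∀ m n → ι (m ℕ.^ n) ≡ ι m ^ℚ n
  ι-^ m zero    = refl
  ι-^ m (suc n) = trans (ι-* m (m ℕ.^ n)) (cong (ι m *_) (ι-^ m n))

  ι-mono-< : ∀ {m n} → m ℕ.< n → ι m < ι n
  ι-mono-< {m} {n} m<n = /-mono-< (+ m) (+ n) 1 1
    (subst₂ ℤ._<_ (sym (ℤ.*-identityʳ _)) (sym (ℤ.*-identityʳ _)) (ℤ.+<+ m<n))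

  ι-mono-≤ : ∀ {m n} → m ℕ.≤ n → ι m ≤ ι n
  ι-mono-≤ {m} {n} m≤n =
    [ (λ m<n → <⇒≤ (ι-mono-< {m} {n} m<n)) , (λ m≡n → ≤-reflexive (cong ι m≡n)) ]′ (ℕ.m≤n⇒m<n∨m≡n m≤n)

  /-*-ι : ∀ m n .{{_ : NonZero n}} → (+ m / n) * ι n ≡ ι m
  /-*-ι m n = trans (/-* (+ m) (+ n) n 1) (/-≡ (+ m ℤ.* + n) (+ m) (n ℕ.* 1) 1 {{ℕ.m*n≢0 n 1}}
    (trans (ℤ.*-identityʳ _) (cong (λ k → + m ℤ.* + k) (sym (ℕ.*-identityʳ n)))))

  ^-pos : ∀ {a} n → 0ℚ < a → 0ℚ < a ^ℚ n
  ^-pos zero    _   = 0<1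
  ^-pos (suc n) 0<a = *-pos 0<a (^-pos n 0<a)

  ^-mono-≤ : ∀ {a b} n → 0ℚ ≤ a → a ≤ b → a ^ℚ n ≤ b ^ℚ n
  ^-mono-≤ zero    _   _   = ≤-refl
  ^-mono-≤ {a} {b} (suc n) 0≤a a≤b = ≤-trans (*-monoˡ-≤ 0≤a (^-mono-≤ n 0≤a a≤b))
    (*-monoʳ-≤ (^-nonNeg n) a≤b)
    where
    ^-nonNeg : ∀ n → 0ℚ ≤ b ^ℚ n
    ^-nonNeg zero    = <⇒≤ 0<1
    ^-nonNeg (suc n) = *-nonNeg (≤-trans 0≤a a≤b) (^-nonNeg n)

  ^-mono-< : ∀ {a b} n .{{_ : NonZero n}} → 0ℚ < a → a < b → a ^ℚ n < b ^ℚ n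
  ^-mono-< {a} {b} (suc n) 0<a a<b = <-≤-trans (*-monoʳ-< (^-pos n 0<a) a<b)
    (*-monoˡ-≤ (<⇒≤ (<-trans 0<a a<b)) (^-mono-≤ n (<⇒≤ 0<a) (<⇒≤ a<b)))

  ^-cancel-< : ∀ {a b} n → 0ℚ < b → a ^ℚ n < b ^ℚ n → a < b
  ^-cancel-< {a} {b} n 0<b lt with a <? b
  ... | yes a<b = a<b
  ... | no  a≮b = ⊥-elim (<-irrefl refl (<-≤-trans lt (^-mono-≤ n (<⇒≤ 0<b) (≮⇒≥ a≮b))))

  ^-cancel-≤ : ∀ {a b} n .{{_ : NonZero n}} → 0ℚ < b → a ^ℚ n ≤ b ^ℚ n → a ≤ b
  ^-cancel-≤ {a} {b} n 0<b le with a ≤? b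
  ... | yes a≤b = a≤b
  ... | no  a≰b = ⊥-elim (<-irrefl refl (<-≤-trans (^-mono-< n 0<b (≰⇒> a≰b)) le))

  1^ : ∀ n → 1ℚ ^ℚ n ≡ 1ℚ
  1^ zero    = refl
  1^ (suc n) = trans (*-identityˡ _) (1^ n)

  ^-assoc-comm : ∀ a m n → (a ^ℚ m) ^ℚ n ≡ (a ^ℚ n) ^ℚ m
  ^-assoc-comm a m n = trans (^ℚ.^-assocʳ a m n)
    (trans (cong (a ^ℚ_) (ℕ.*-comm m n)) (sym (^ℚ.^-assocʳ a n m)))

  -- Archimedean property, growth and one-sided continuity of powers.

  p≤ι∣↥p∣ : ∀ p → p ≤ ι ℤ.∣ ↥ p ∣
  p≤ι∣↥p∣ p@(mkℚ i d-1 _) = subst (p ≤_) (sym (/1≡mkℚ (+ ℤ.∣ i ∣)))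
    (*≤* (subst (ℤ._≤ + ℤ.∣ i ∣ ℤ.* + suc d-1)
    (sym (ℤ.*-identityʳ i)) (lemma i)))
    where
    lemma : ∀ i → i ℤ.≤ + ℤ.∣ i ∣ ℤ.* + suc d-1
    lemma (+ n)    = subst (+ n ℤ.≤_) (ℤ.pos-* n (suc d-1)) (ℤ.+≤+ (ℕ.m≤m*n n (suc d-1)))
    lemma -[1+ n ] = ℤ.-≤+

  *-cancel-inverse : ∀ {r z} x → r * z ≡ 1ℚ → x * r * z ≡ x
  *-cancel-inverse {r} {z} x rz≡1 =
    trans (*-assoc x r z) (trans (cong (x *_) rz≡1) (*-identityʳ x))

  archimedean : ∀ c {δ} → 0ℚ < δ → ∃[ n ] NonZero n × c < ι n * δ
  archimedean c {δ} 0<δ =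
    let r , _ , rδ≡1 = inverse 0<δ
        n = ℤ.∣ ↥ (c * r) ∣
    in suc n , _ , subst (_< ι (suc n) * δ) (*-cancel-inverse c rδ≡1)
         (*-monoʳ-< {c * r} {ι (suc n)} 0<δ
           (≤-<-trans (p≤ι∣↥p∣ (c * r)) (ι-mono-< {n} {suc n} (ℕ.n<1+n n))))

  bernoulli-step : ∀ {a δ x y k} → 0ℚ < a → 0ℚ ≤ δ → 0ℚ ≤ x → 0ℚ ≤ k →
    x * (a + k * δ) ≤ y * a → a * x * (a + (1ℚ + k) * δ) ≤ (a + δ) * y * a
  bernoulli-step {a} {δ} {x} {y} {k} 0<a 0≤δ 0≤x 0≤k IH = begin
    a * x * (a + (1ℚ + k) * δ)                      ≡⟨ +-identityʳ _ ⟨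
    a * x * (a + (1ℚ + k) * δ) + 0ℚ                 ≤⟨ +-monoʳ-≤ (a * x * (a + (1ℚ + k) * δ)) slack ⟩
    a * x * (a + (1ℚ + k) * δ) + x * (k * (δ * δ))  ≡⟨ lemma a δ x k ⟩
    (a + δ) * (x * (a + k * δ))                     ≤⟨ *-monoˡ-≤ (+-mono-≤ (<⇒≤ 0<a) 0≤δ) IH ⟩
    (a + δ) * (y * a)                               ≡⟨ *-assoc (a + δ) y a ⟨
    (a + δ) * y * a                                 ∎
    where
    open ≤-Reasoning
    slack : 0ℚ ≤ x * (k * (δ * δ))
    slack = *-nonNeg 0≤x (*-nonNeg 0≤k (*-nonNeg 0≤δ 0≤δ))
    lemma : ∀ a δ x y → a * x * (a + (1ℚ + y) * δ) + x * (y * (δ * δ)) ≡ (a + δ) * (x * (a + y * δ))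
    lemma = solve-∀ ℚ-ring

  -- Bernoulli's inequality 1 + n x ≤ (1 + x)^n for x = δ / a, with the denominators cleared. The
  -- inductive step drops the term with δ².
  bernoulli : ∀ {a δ} → 0ℚ < a → 0ℚ ≤ δ → ∀ n → a ^ℚ n * (a + ι n * δ) ≤ (a + δ) ^ℚ n * a
  bernoulli {a} {δ} 0<a 0≤δ zero    = ≤-reflexive (lemma a δ)
    where
    lemma : ∀ a δ → 1ℚ * (a + 0ℚ * δ) ≡ 1ℚ * a
    lemma = solve-∀ ℚ-ring
  bernoulli {a} {δ} 0<a 0≤δ (suc n) =
    subst (λ k → a * a ^ℚ n * (a + k * δ) ≤ (a + δ) * (a + δ) ^ℚ n * a) (sym (ι-+ 1 n))
      (bernoulli-step 0<a 0≤δ (<⇒≤ (^-pos n 0<a)) (ι-mono-≤ {0} {n} z≤n) (bernoulli 0<a 0≤δ n))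

  power-gap′ : ∀ {a g} → 0ℚ < a → a < g → ∀ c n → c * a < ι n * (g - a) → c * a ^ℚ n < g ^ℚ n
  power-gap′ {a} {g} 0<a a<g c n lt = *-cancelʳ-< 0<a (begin-strict
    c * a ^ℚ n * a              ≡⟨ lemma₁ c (a ^ℚ n) a ⟩
    a ^ℚ n * (c * a)            <⟨ *-monoˡ-< (^-pos n 0<a) lt ⟩
    a ^ℚ n * (ι n * δ)          ≡⟨ cong (a ^ℚ n *_) (+-identityˡ (ι n * δ)) ⟨
    a ^ℚ n * (0ℚ + ι n * δ)     ≤⟨ *-monoˡ-≤ (<⇒≤ (^-pos n 0<a)) (+-monoˡ-≤ (ι n * δ) (<⇒≤ 0<a)) ⟩
    a ^ℚ n * (a + ι n * δ)      ≤⟨ bernoulli 0<a (<⇒≤ (p<q⇒0<q-p a<g)) n ⟩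
    (a + δ) ^ℚ n * a            ≡⟨ cong (λ x → x ^ℚ n * a) (lemma₂ a g) ⟩
    g ^ℚ n * a                  ∎)
    where
    open ≤-Reasoning
    δ = g - a
    lemma₁ : ∀ c x a → c * x * a ≡ x * (c * a)
    lemma₁ = solve-∀ ℚ-ring
    lemma₂ : ∀ a g → a + (g - a) ≡ g
    lemma₂ = solve-∀ ℚ-ring

  -- For c = u this opens a gap between a^n and g^n that is wide enough to contain an integer power
  -- of u.
  power-gap : ∀ {a g} → 0ℚ < a → a < g → ∀ c → ∃[ n ] NonZero n × c * a ^ℚ n < g ^ℚ n
  power-gap {a} {g} 0<a a<g c =
    let n , n≢0 , lt = archimedean (c * a) {g - a} (p<q⇒0<q-p {a} {g} a<g)
    in n , n≢0 , power-gap′ {a} {g} 0<a a<g c n lt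

  -- The witness is any rational strictly between x / z and y.
  *-rounded : ∀ {x y z} → 0ℚ ≤ x → 0ℚ < z → x < y * z → ∃[ w ] 0ℚ < w × w < y × x < w * z
  *-rounded {x} {y} {z} 0≤x 0<z x<yz =
    let r , 0<r , rz≡1 = inverse 0<z
        eq = *-cancel-inverse x rz≡1
        w , xr<w , w<y = <-dense (*-cancelʳ-< {x * r} {y} 0<z (subst (_< y * z) (sym eq) x<yz))
    in w , ≤-<-trans (*-nonNeg 0≤x (<⇒≤ 0<r)) xr<w , w<y ,
       subst (_< w * z) eq (*-monoʳ-< {x * r} {w} 0<z xr<w)

  ^-suc : ∀ a n → a ^ℚ suc n ≡ a * a ^ℚ n
  ^-suc a n = refl

  -- Continuity of the power from the left, without roots. The factors `g` are lowered one at a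
  -- time, those already lowered being stored in `c`; the largest of the lowered bases then serves
  -- for all factors.
  ^-rounded : ∀ {x g} c n → 0ℚ ≤ x → 0ℚ < g → 0ℚ < c → x < g ^ℚ n * c →
    ∃[ v ] 0ℚ < v × v < g × x < v ^ℚ n * c
  ^-rounded {x} {g} c zero 0≤x 0<g 0<c lt = step (<-dense 0<g)
    where
    step : (∃[ v ] 0ℚ < v × v < g) → ∃[ v ] 0ℚ < v × v < g × x < v ^ℚ 0 * c
    step (v , 0<v , v<g) = v , 0<v , v<g , subst (λ y → x < y * c) {g ^ℚ 0} {v ^ℚ 0} refl lt
  ^-rounded {x} {g} c (suc n) 0≤x 0<g 0<c lt = step₁ (*-rounded {x} {g} {g ^ℚ n * c} 0≤x
      (*-pos {g ^ℚ n} {c} (^-pos n 0<g) 0<c) (subst (x <_) eq lt))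
    where
    eq : g ^ℚ suc n * c ≡ g * (g ^ℚ n * c)
    eq = trans (cong (_* c) (^-suc g n)) (*-assoc g (g ^ℚ n) c)
    lemma₁ : ∀ v y c → v * (y * c) ≡ y * (v * c)
    lemma₁ = solve-∀ ℚ-ring
    lemma₂ : ∀ y v c → y * (v * c) ≡ v * y * c
    lemma₂ = solve-∀ ℚ-ring
    Goal = ∃[ v ] 0ℚ < v × v < g × x < v ^ℚ suc n * c
    finish : ∀ v → 0ℚ < v → v < g → x < v ^ℚ n * (v * c) → Goal
    finish v 0<v v<g lt′ = v , 0<v , v<g ,
      subst (x <_) (trans (lemma₂ (v ^ℚ n) v c) (cong (_* c) (sym (^-suc v n)))) lt′
    step₂ : ∀ v₁ → 0ℚ < v₁ → v₁ < g → (∃[ v ] 0ℚ < v × v < g × x < v ^ℚ n * (v₁ * c)) → Goal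
    step₂ v₁ 0<v₁ v₁<g (v₂ , 0<v₂ , v₂<g , lt₂) =
      [ (λ v₁≤v₂ → finish v₂ 0<v₂ v₂<g (<-≤-trans lt₂
             (*-monoˡ-≤ {v₁ * c} {v₂ * c} {v₂ ^ℚ n} (<⇒≤ (^-pos n 0<v₂))
               (*-monoʳ-≤ {v₁} {v₂} {c} (<⇒≤ 0<c) v₁≤v₂))))
       , (λ v₂≤v₁ → finish v₁ 0<v₁ v₁<g (<-≤-trans lt₂
             (*-monoʳ-≤ {v₂ ^ℚ n} {v₁ ^ℚ n} {v₁ * c} (<⇒≤ (*-pos {v₁} {c} 0<v₁ 0<c))
               (^-mono-≤ n (<⇒≤ 0<v₂) v₂≤v₁))))
       ]′ (≤-total v₁ v₂)
    step₁ : (∃[ v ] 0ℚ < v × v < g × x < v * (g ^ℚ n * c)) → Goal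
    step₁ (v₁ , 0<v₁ , v₁<g , lt₁) = step₂ v₁ 0<v₁ v₁<g
      (^-rounded {x} {g} (v₁ * c) n 0≤x 0<g (*-pos {v₁} {c} 0<v₁ 0<c)
            (subst (x <_) (lemma₁ v₁ (g ^ℚ n) c) lt₁))

  <-≤-connex : ∀ x y → x < y ⊎ y ≤ x
  <-≤-connex x y with x <? y
  ... | yes x<y = inj₁ x<y
  ... | no  x≮y = inj₂ (≮⇒≥ x≮y)

  -- Integer powers of u and the comparison of logarithms through them.

  module Powers (u : ℕ) .{{u≢0 : NonZero u}} (1<u : 1 ℕ.< u) where

    U V : ℚ
    U = + u / 1
    V = + 1 / u

    VU≡1 : V * U ≡ 1ℚ
    VU≡1 = /-*-ι 1 u

    1<U : 1ℚ < U
    1<U = ι-mono-< {1} {u} 1<u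

    0<U : 0ℚ < U
    0<U = <-trans 0<1 1<U

    0<V : 0ℚ < V
    0<V = *-cancelʳ-< {0ℚ} {V} {U} 0<U (subst₂ _<_ (sym (*-zeroˡ U)) (sym VU≡1) 0<1)

    ^ℤ-pos : ∀ i → 0ℚ < u ^ℤ i
    ^ℤ-pos (+ n)    = ^-pos n 0<U
    ^ℤ-pos -[1+ n ] = ^-pos (suc n) 0<V

    ^ℤ-suc : ∀ i → u ^ℤ ℤ.suc i ≡ U * u ^ℤ i
    ^ℤ-suc (+ n)          = ^-suc U n
    ^ℤ-suc -[1+ zero ]    = sym (trans (cong (U *_) (*-identityʳ V)) (trans (*-comm U V) VU≡1))
    ^ℤ-suc -[1+ suc n ]   = sym (trans (cong (U *_) (^-suc V (suc n)))
      (trans (sym (*-assoc U V (V ^ℚ suc n)))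
      (trans (cong (_* V ^ℚ suc n) (trans (*-comm U V) VU≡1)) (*-identityˡ (V ^ℚ suc n)))))

    ^ℤ-+ : ∀ i n → u ^ℤ (+ n ℤ.+ i) ≡ U ^ℚ n * u ^ℤ i
    ^ℤ-+ i zero    = trans (cong (u ^ℤ_) (ℤ.+-identityˡ i)) (sym (*-identityˡ (u ^ℤ i)))
    ^ℤ-+ i (suc n) = trans (cong (u ^ℤ_) (ℤ.+-assoc (+ 1) (+ n) i))
      (trans (^ℤ-suc (+ n ℤ.+ i)) (trans (cong (U *_) (^ℤ-+ i n))
      (trans (sym (*-assoc U (U ^ℚ n) (u ^ℤ i))) (cong (_* u ^ℤ i) (sym (^-suc U n))))))

    ^ℤ-step : ∀ i → u ^ℤ i < u ^ℤ ℤ.suc i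
    ^ℤ-step i = subst₂ _<_ (*-identityˡ (u ^ℤ i)) (sym (^ℤ-suc i))
      (*-monoʳ-< {1ℚ} {U} {u ^ℤ i} (^ℤ-pos i) 1<U)

    ^ℤ-grow : ∀ i n → u ^ℤ i ≤ u ^ℤ (+ n ℤ.+ i)
    ^ℤ-grow i zero    = ≤-reflexive (cong (u ^ℤ_) (sym (ℤ.+-identityˡ i)))
    ^ℤ-grow i (suc n) = ≤-trans (^ℤ-grow i n) (≤-trans (<⇒≤ (^ℤ-step (+ n ℤ.+ i)))
      (≤-reflexive (cong (u ^ℤ_) (sym (ℤ.+-assoc (+ 1) (+ n) i)))))

    ^ℤ-mono-≤ : ∀ {i j} → i ℤ.≤ j → u ^ℤ i ≤ u ^ℤ j
    ^ℤ-mono-≤ {i} {j} i≤j = subst (λ k → u ^ℤ i ≤ u ^ℤ k) eq (^ℤ-grow i ℤ.∣ j ℤ.- i ∣)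
      where
      lemma : ∀ i j → j ℤ.- i ℤ.+ i ≡ j
      lemma = ℤ-Solver.solve-∀
      eq : + ℤ.∣ j ℤ.- i ∣ ℤ.+ i ≡ j
      eq = trans (cong (ℤ._+ i) (ℤ.0≤i⇒+∣i∣≡i (ℤ.i≤j⇒0≤j-i i≤j))) (lemma i j)

    ^ℤ-cancel-< : ∀ {i j} → u ^ℤ i < u ^ℤ j → i ℤ.< j
    ^ℤ-cancel-< {i} {j} lt = ℤ.≰⇒> λ j≤i → <-irrefl refl (<-≤-trans lt (^ℤ-mono-≤ j≤i))

    ^ℤ-cancel-≤ : ∀ {i j} → u ^ℤ i ≤ u ^ℤ j → i ℤ.≤ j
    ^ℤ-cancel-≤ {i} {j} le = ℤ.≮⇒≥ λ j<i → <-irrefl refl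
      (<-≤-trans (<-≤-trans (^ℤ-step j) (^ℤ-mono-≤ (ℤ.i<j⇒suc[i]≤j j<i))) le)

    ^ℤ-* : ∀ i n → (u ^ℤ i) ^ℚ n ≡ u ^ℤ (i ℤ.* + n)
    ^ℤ-* (+ k)    n       = trans (^ℚ.^-assocʳ U k n) (cong (u ^ℤ_) (ℤ.pos-* k n))
    ^ℤ-* -[1+ k ] zero    = cong (u ^ℤ_) (sym (ℤ.*-zeroʳ -[1+ k ]))
    ^ℤ-* -[1+ k ] (suc n) = ^ℚ.^-assocʳ V (suc k) (suc n)

    -- The integer part of log_u h. Powers of u exceeding 1/h and h bound the logarithm from both
    -- sides, and a search downwards from the upper bound finds it.
    integer-log : ∀ {h} → 0ℚ < h → ∃[ p ] u ^ℤ p ≤ h × h < u ^ℤ ℤ.suc p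
    integer-log {h} 0<h = start (inverse 0<h)
      where
      Goal : Set
      Goal = ∃[ p ] u ^ℤ p ≤ h × h < u ^ℤ ℤ.suc p
      search : ∀ {p} n → u ^ℤ p ≤ h → h < u ^ℤ (+ n ℤ.+ p) → Goal
      search {p} zero    le lt =
        ⊥-elim (<-irrefl refl (<-≤-trans (subst (λ k → h < u ^ℤ k) (ℤ.+-identityˡ p) lt) le))
      search {p} (suc n) le lt = [ search {p} n le , (λ ge → + n ℤ.+ p , ge ,
        subst (λ k → h < u ^ℤ k) (ℤ.+-assoc (+ 1) (+ n) p) lt) ]′ (<-≤-connex h (u ^ℤ (+ n ℤ.+ p)))
      start : (∃[ r ] 0ℚ < r × r * h ≡ 1ℚ) → Goal
      start (r , 0<r , rh≡1) = go (power-gap 0<1 1<U r) (power-gap 0<1 1<U h)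
        where
        go : (∃[ n ] NonZero n × r * 1ℚ ^ℚ n < U ^ℚ n) → (∃[ n ] NonZero n × h * 1ℚ ^ℚ n < U ^ℚ n) → Goal
        go (n₀ , _ , lt₀) (n₁ , _ , lt₁) = search {p₀} (n₁ ℕ.+ n₀) (<⇒≤ below)
          (subst₂ (λ x k → x < u ^ℤ k) (trans (cong (h *_) (1^ n₁)) (*-identityʳ h)) eq₁ lt₁)
          where
          p₀ : ℤ
          p₀ = ℤ.- (+ n₀)
          W : ℚ
          W = u ^ℤ p₀
          UW≡1 : U ^ℚ n₀ * W ≡ 1ℚ
          UW≡1 = trans (sym (^ℤ-+ p₀ n₀)) (cong (u ^ℤ_) (ℤ.+-inverseʳ (+ n₀)))
          lt₀′ : r < U ^ℚ n₀
          lt₀′ = subst (_< U ^ℚ n₀) (trans (cong (r *_) (1^ n₀)) (*-identityʳ r)) lt₀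
          below : W < h
          below = subst₂ _<_
            (trans (cong (_* W) rh≡1) (*-identityˡ W))
            (trans (lemma (U ^ℚ n₀) h W) (trans (cong (_* h) UW≡1) (*-identityˡ h)))
            (*-monoʳ-< {r * h} {U ^ℚ n₀ * h} {W} (^ℤ-pos p₀) (*-monoʳ-< {r} {U ^ℚ n₀} {h} 0<h lt₀′))
            where
            lemma : ∀ x h w → x * h * w ≡ x * w * h
            lemma = solve-∀ ℚ-ring
          eq₁ : + n₁ ≡ + (n₁ ℕ.+ n₀) ℤ.+ p₀
          eq₁ = sym (trans (ℤ.+-assoc (+ n₁) (+ n₀) p₀)
                (trans (cong (λ k → + n₁ ℤ.+ k) (ℤ.+-inverseʳ (+ n₀))) (ℤ.+-identityʳ (+ n₁))))

    -- In logarithms to base u: from p/d ≤ log a, m log a ≤ n log b and log b ≤ q/e follows m p/d ≤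
    -- n q/e, which times d e is an inequality of integers. Raising the three facts to the powers m
    -- e, d e and n d links them into one chain from a power of u to a power of u; the variants
    -- differ in which end is strict.
    module Separation {a b : ℚ} (0<a : 0ℚ < a) (0<b : 0ℚ < b) (p q : ℤ) (d e m n : ℕ)
      (a^m≤b^n : a ^ℚ m ≤ b ^ℚ n) where

      private
        left : (u ^ℤ p) ^ℚ (m ℕ.* e) ≡ u ^ℤ (p ℤ.* + m ℤ.* + e)
        left = trans (^ℤ-* p (m ℕ.* e)) (cong (u ^ℤ_)
          (trans (cong (p ℤ.*_) (ℤ.pos-* m e)) (sym (ℤ.*-assoc p (+ m) (+ e)))))

        right : (u ^ℤ q) ^ℚ (n ℕ.* d) ≡ u ^ℤ (q ℤ.* + n ℤ.* + d)
        right = trans (^ℤ-* q (n ℕ.* d)) (cong (u ^ℤ_)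
          (trans (cong (q ℤ.*_) (ℤ.pos-* n d)) (sym (ℤ.*-assoc q (+ n) (+ d)))))

        middle : (a ^ℚ d) ^ℚ (m ℕ.* e) ≤ (b ^ℚ e) ^ℚ (n ℕ.* d)
        middle = subst₂ _≤_ eqa eqb (^-mono-≤ (d ℕ.* e) (<⇒≤ (^-pos m 0<a)) a^m≤b^n)
          where
          eqa : (a ^ℚ m) ^ℚ (d ℕ.* e) ≡ (a ^ℚ d) ^ℚ (m ℕ.* e)
          eqa = trans (^ℚ.^-assocʳ a m (d ℕ.* e)) (trans (cong (a ^ℚ_) (lemma m d e))
                (sym (^ℚ.^-assocʳ a d (m ℕ.* e))))
            where
            lemma : ∀ m d e → m ℕ.* (d ℕ.* e) ≡ d ℕ.* (m ℕ.* e)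
            lemma = ℕ-Solver.solve-∀
          eqb : (b ^ℚ n) ^ℚ (d ℕ.* e) ≡ (b ^ℚ e) ^ℚ (n ℕ.* d)
          eqb = trans (^ℚ.^-assocʳ b n (d ℕ.* e)) (trans (cong (b ^ℚ_) (lemma n d e))
                (sym (^ℚ.^-assocʳ b e (n ℕ.* d))))
            where
            lemma : ∀ n d e → n ℕ.* (d ℕ.* e) ≡ e ℕ.* (n ℕ.* d)
            lemma = ℕ-Solver.solve-∀

      sep-<-≤ : .{{_ : NonZero m}} .{{_ : NonZero e}} →
        u ^ℤ p < a ^ℚ d → b ^ℚ e ≤ u ^ℤ q → p ℤ.* + m ℤ.* + e ℤ.< q ℤ.* + n ℤ.* + d
      sep-<-≤ lt le = ^ℤ-cancel-< (subst₂ _<_ left right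
        (<-≤-trans (^-mono-< (m ℕ.* e) {{ℕ.m*n≢0 m e}} (^ℤ-pos p) lt)
        (≤-trans middle (^-mono-≤ (n ℕ.* d) (<⇒≤ (^-pos e 0<b)) le))))

      sep-≤-≤ : u ^ℤ p ≤ a ^ℚ d → b ^ℚ e ≤ u ^ℤ q → p ℤ.* + m ℤ.* + e ℤ.≤ q ℤ.* + n ℤ.* + d
      sep-≤-≤ le₁ le₂ = ^ℤ-cancel-≤ (subst₂ _≤_ left right
        (≤-trans (^-mono-≤ (m ℕ.* e) (<⇒≤ (^ℤ-pos p)) le₁)
        (≤-trans middle (^-mono-≤ (n ℕ.* d) (<⇒≤ (^-pos e 0<b)) le₂))))

      sep-≤-< : .{{_ : NonZero n}} .{{_ : NonZero d}} →
        u ^ℤ p ≤ a ^ℚ d → b ^ℚ e < u ^ℤ q → p ℤ.* + m ℤ.* + e ℤ.< q ℤ.* + n ℤ.* + d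
      sep-≤-< le lt = ^ℤ-cancel-< (subst₂ _<_ left right
        (≤-<-trans (^-mono-≤ (m ℕ.* e) (<⇒≤ (^ℤ-pos p)) le)
        (≤-<-trans middle (^-mono-< (n ℕ.* d) {{ℕ.m*n≢0 n d}} (^-pos e 0<b) lt))))

    Above-cancel : ∀ {r s a b} m n .{{_ : NonZero m}} → AbovePower u r a → 0ℚ < b → a ^ℚ m ≤ b ^ℚ n →
      b ^ℚ ↧ₙ s ≤ u ^ℤ ↥ s → r * ι m < s * ι n
    Above-cancel {r} {s} m n (0<a , lt) 0<b le₁ le₂ = subst₂ _<_ (sym (*-ι r m)) (sym (*-ι s n))
      (/-mono-< (↥ r ℤ.* + m) (↥ s ℤ.* + n) (↧ₙ r) (↧ₙ s)
        (Separation.sep-<-≤ 0<a 0<b (↥ r) (↥ s) (↧ₙ r) (↧ₙ s) m n le₁ lt le₂))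

    Below-cancel : ∀ {r s a b} m n .{{_ : NonZero n}} → 0ℚ < a → 0ℚ < b → b ^ℚ ↧ₙ s < u ^ℤ ↥ s →
      a ^ℚ m ≤ b ^ℚ n → u ^ℤ ↥ r ≤ a ^ℚ ↧ₙ r → r * ι m < s * ι n
    Below-cancel {r} {s} m n 0<a 0<b lt le₁ le₂ = subst₂ _<_ (sym (*-ι r m)) (sym (*-ι s n))
      (/-mono-< (↥ r ℤ.* + m) (↥ s ℤ.* + n) (↧ₙ r) (↧ₙ s)
        (Separation.sep-≤-< 0<a 0<b (↥ r) (↥ s) (↧ₙ r) (↧ₙ s) m n le₁ le₂ lt))

    Below-pos : ∀ {r a} → 0ℚ < a → BelowPower u r a → a ^ℚ ↧ₙ r < u ^ℤ ↥ r
    Below-pos 0<a (inj₁ a≤0) = ⊥-elim (<-irrefl refl (<-≤-trans 0<a a≤0))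
    Below-pos 0<a (inj₂ lt)  = lt

    -- In logarithmic terms: if r < log a, m log a ≤ n log b and s n ≤ r m, then s < log b.
    Above-mono : ∀ {r s a b} m n .{{_ : NonZero m}} → 0ℚ < b → a ^ℚ m ≤ b ^ℚ n → s * ι n ≤ r * ι m →
      AbovePower u r a → AbovePower u s b
    Above-mono {r} {s} {a} {b} m n 0<b le s≤r above =
      [ (λ lt → 0<b , lt)
      , (λ ge → ⊥-elim (<-irrefl refl (<-≤-trans (Above-cancel {r} {s} m n above 0<b le ge) s≤r)))
      ]′ (<-≤-connex (u ^ℤ ↥ s) (b ^ℚ ↧ₙ s))

    Below-mono : ∀ {r s a b} m n .{{_ : NonZero n}} → 0ℚ < a → 0ℚ < b → a ^ℚ m ≤ b ^ℚ n →
      r * ι n ≤ s * ι m → BelowPower u r b → BelowPower u s a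
    Below-mono {r} {s} {a} {b} m n 0<a 0<b le r≤s below =
      [ inj₂
      , (λ ge → ⊥-elim (<-irrefl refl (<-≤-trans
          (Below-cancel {s} {r} m n 0<a 0<b (Below-pos {r} 0<b below) le ge) r≤s)))
      ]′ (<-≤-connex (a ^ℚ ↧ₙ s) (u ^ℤ ↥ s))

  -- `i / n` is reduced to lowest terms, so cross multiplication is what ties its numerator and
  -- denominator to `i` and `n`.
  /-cross : ∀ i n .{{_ : NonZero n}} → ↥ (i / n) ℤ.* + n ≡ i ℤ.* ↧ (i / n)
  /-cross i n@(suc _) = trans (cong (ℤ._* + n) (sym (↥ᵘ-toℚᵘ (i / n))))
    (trans (ℚᵘ.drop-*≡* (/-≃ i n)) (cong (i ℤ.*_) (↧ᵘ-toℚᵘ (i / n))))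

  -- Logarithms of positive rationals as Dedekind cuts.

  module Logarithm (u : ℕ) .{{u≢0 : NonZero u}} (1<u : 1 ℕ.< u) where
    open Powers u 1<u

    -- `BelowPower` reads off the reduced fraction; this makes it available from an arbitrary
    -- representation p / n.
    Below-/ : ∀ {a} p n .{{_ : NonZero n}} → 0ℚ < a → a ^ℚ n < u ^ℤ p → BelowPower u (p / n) a
    Below-/ {a} p n 0<a lt = [ inj₂ , (λ ge → ⊥-elim (ℤ.<-irrefl eq
        (Separation.sep-≤-< 0<a 0<a (↥ r) p (↧ₙ r) n 1 1 ≤-refl ge lt))) ]′
      (<-≤-connex (a ^ℚ ↧ₙ r) (u ^ℤ ↥ r))
      where
      r : ℚ
      r = p / n
      eq : ↥ r ℤ.* + 1 ℤ.* + n ≡ p ℤ.* + 1 ℤ.* ↧ r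
      eq = trans (cong (ℤ._* + n) (ℤ.*-identityʳ (↥ r)))
           (trans (/-cross p n) (cong (ℤ._* ↧ r) (sym (ℤ.*-identityʳ p))))

    Above-/ : ∀ {a} p n .{{_ : NonZero n}} → 0ℚ < a → u ^ℤ p < a ^ℚ n → AbovePower u (p / n) a
    Above-/ {a} p n 0<a lt = 0<a , [ (λ lt′ → lt′) , (λ ge → ⊥-elim (ℤ.<-irrefl eq
        (Separation.sep-<-≤ 0<a 0<a p (↥ r) n (↧ₙ r) 1 1 ≤-refl lt ge))) ]′
      (<-≤-connex (u ^ℤ ↥ r) (a ^ℚ ↧ₙ r))
      where
      r : ℚ
      r = p / n
      eq : p ℤ.* + 1 ℤ.* ↧ r ≡ ↥ r ℤ.* + 1 ℤ.* + n
      eq = sym (trans (cong (ℤ._* + n) (ℤ.*-identityʳ (↥ r)))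
           (trans (/-cross p n) (cong (ℤ._* ↧ r) (sym (ℤ.*-identityʳ p)))))

    -- Choose n with u a^n < c^n and let p be the integer part of log_u (a^n). Then a^n < u^(p+1) ≤
    -- u a^n < c^n, so (p + 1) / n lies strictly between the two logarithms.
    dense : ∀ {a c} → 0ℚ < a → a < c → ∃[ r ] BelowPower u r a × AbovePower u r c
    dense {a} {c} 0<a a<c = step₁ (power-gap 0<a a<c U)
      where
      Goal : Set
      Goal = ∃[ r ] BelowPower u r a × AbovePower u r c
      step₂ : ∀ n .{{_ : NonZero n}} → U * a ^ℚ n < c ^ℚ n →
        (∃[ p ] u ^ℤ p ≤ a ^ℚ n × a ^ℚ n < u ^ℤ ℤ.suc p) → Goal
      step₂ n gap (p , le , lt) = ℤ.suc p / n , Below-/ (ℤ.suc p) n 0<a lt ,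
        Above-/ (ℤ.suc p) n (<-trans 0<a a<c)
          (≤-<-trans (≤-trans (≤-reflexive (^ℤ-suc p)) (*-monoˡ-≤ {u ^ℤ p} {a ^ℚ n} {U} (<⇒≤ 0<U) le)) gap)
      step₁ : (∃[ n ] NonZero n × U * a ^ℚ n < c ^ℚ n) → Goal
      step₁ (n , n≢0 , gap) = step₂ n {{n≢0}} gap (integer-log (^-pos n 0<a))

    Above-^ℤ : ∀ {t} i → AbovePower u t (u ^ℤ i) → t < i / 1
    Above-^ℤ {t} i (_ , lt) = subst (_< i / 1) (↥p/↧p≡p t) (/-mono-< (↥ t) i (↧ₙ t) 1
      (subst₂ ℤ._<_ (cong (ℤ._* + 1) (ℤ.*-identityʳ (↥ t))) (cong (ℤ._* ↧ t) (ℤ.*-identityʳ i))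
        (Separation.sep-<-≤ (^ℤ-pos i) (^ℤ-pos i) (↥ t) i (↧ₙ t) 1 1 1 ≤-refl lt
          (≤-reflexive (*-identityʳ (u ^ℤ i))))))

    Below-^ℤ : ∀ {t} i → BelowPower u t (u ^ℤ i) → i / 1 < t
    Below-^ℤ {t} i below = subst (i / 1 <_) (↥p/↧p≡p t) (/-mono-< i (↥ t) 1 (↧ₙ t)
      (subst₂ ℤ._<_ (cong (ℤ._* ↧ t) (ℤ.*-identityʳ i)) (cong (ℤ._* + 1) (ℤ.*-identityʳ (↥ t)))
        (Separation.sep-≤-< (^ℤ-pos i) (^ℤ-pos i) i (↥ t) 1 (↧ₙ t) 1 1 ≤-refl
          (≤-reflexive (sym (*-identityʳ (u ^ℤ i)))) (Below-pos {t} (^ℤ-pos i) below))))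

    module _ (r : ℚ) where
      private
        d = ↧ₙ r

        scale : ℚ → ℚ
        scale t = t * (+ 1 / d)

        scale-ι : ∀ t → scale t * ι d ≡ t * 1ℚ
        scale-ι t = trans (*-assoc t (+ 1 / d) (ι d)) (cong (t *_) (/-*-ι 1 d))

        scale-< : ∀ {t} → t < ↥ r / 1 → scale t < r
        scale-< {t} lt = *-cancelʳ-< {scale t} {r} {ι d} (ι-mono-< {0} {d} (s≤s z≤n))
          (subst₂ _<_ (sym (trans (scale-ι t) (*-identityʳ t))) (sym (*-ι-↧ r)) lt)

        scale-> : ∀ {t} → ↥ r / 1 < t → r < scale t
        scale-> {t} lt = *-cancelʳ-< {r} {scale t} {ι d} (ι-mono-< {0} {d} (s≤s z≤n))
          (subst₂ _<_ (sym (*-ι-↧ r)) (sym (trans (scale-ι t) (*-identityʳ t))) lt)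

      -- For r = p / d the hypothesis is a^d < u^p. A rational t strictly between the logarithms of
      -- these two numbers has t < p, and t / d is the required s.
      Below-rounded : ∀ {a} → 0ℚ < a → BelowPower u r a → ∃[ s ] s < r × BelowPower u s a
      Below-rounded {a} 0<a below = step (dense (^-pos d 0<a) (Below-pos {r} 0<a below))
        where
        step : (∃[ t ] BelowPower u t (a ^ℚ d) × AbovePower u t (u ^ℤ ↥ r)) →
          ∃[ s ] s < r × BelowPower u s a
        step (t , below′ , above′) = scale t , scale-< {t} (Above-^ℤ {t} (↥ r) above′) ,
          Below-mono {t} {scale t} {a} {a ^ℚ d} d 1 0<a (^-pos d 0<a)
            (≤-reflexive (sym (*-identityʳ (a ^ℚ d)))) (≤-reflexive (sym (scale-ι t))) below′

      Above-rounded : ∀ {a} → AbovePower u r a → ∃[ s ] r < s × AbovePower u s a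
      Above-rounded {a} (0<a , lt) = step (dense (^ℤ-pos (↥ r)) lt)
        where
        step : (∃[ t ] BelowPower u t (u ^ℤ ↥ r) × AbovePower u t (a ^ℚ d)) →
          ∃[ s ] r < s × AbovePower u s a
        step (t , below′ , above′) = scale t , scale-> {t} (Below-^ℤ {t} (↥ r) below′) ,
          Above-mono {t} {scale t} {a ^ℚ d} {a} 1 d 0<a
            (≤-reflexive (*-identityʳ (a ^ℚ d))) (≤-reflexive (scale-ι t)) above′

      -- Here the base is moved and the exponent kept. It is needed because an inequality of cuts
      -- from `fromℚ a` gives information at rationals strictly below `a` only.
      Above-rounded-base : ∀ {a} → AbovePower u r a → ∃[ v ] v < a × AbovePower u r v
      Above-rounded-base {a} (0<a , lt) = step
        (^-rounded 1ℚ d (<⇒≤ (^ℤ-pos (↥ r))) 0<a 0<1 (subst (u ^ℤ ↥ r <_) (sym (*-identityʳ (a ^ℚ d))) lt))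
        where
        step : (∃[ v ] 0ℚ < v × v < a × u ^ℤ ↥ r < v ^ℚ d * 1ℚ) → ∃[ v ] v < a × AbovePower u r v
        step (v , 0<v , v<a , lt′) = v , v<a , 0<v , subst (u ^ℤ ↥ r <_) (*-identityʳ (v ^ℚ d)) lt′

    Above-≤ : ∀ {r s a} → s ≤ r → AbovePower u r a → AbovePower u s a
    Above-≤ {r} {s} s≤r above@(0<a , _) = Above-mono {r} {s} 1 1 0<a ≤-refl
      (subst₂ _≤_ (sym (*-identityʳ s)) (sym (*-identityʳ r)) s≤r) above

    Below-≤ : ∀ {r s a} → 0ℚ < a → r ≤ s → BelowPower u r a → BelowPower u s a
    Below-≤ {r} {s} 0<a r≤s = Below-mono {r} {s} 1 1 0<a 0<a ≤-refl
      (subst₂ _≤_ (sym (*-identityʳ r)) (sym (*-identityʳ s)) r≤s)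

    Above-Below : ∀ {r s a} → AbovePower u r a → BelowPower u s a → r < s
    Above-Below {r} {s} above@(0<a , _) below = subst₂ _<_ (*-identityʳ r) (*-identityʳ s)
      (Above-cancel {r} {s} 1 1 above 0<a ≤-refl (<⇒≤ (Below-pos {s} 0<a below)))

    Below-Above-base : ∀ {r a c} → 0ℚ < a → BelowPower u r a → AbovePower u r c → a < c
    Below-Above-base {r} 0<a below (0<c , lt) =
      ^-cancel-< (↧ₙ r) 0<c (<-trans (Below-pos {r} 0<a below) lt)

    -- `AbovePower u r a` places `a` above u^r, hence r below log a; this is why it forms the lower
    -- half.
    log : ℚ → Cut
    log a = record { lower = λ r → AbovePower u r a ; upper = λ r → BelowPower u r a }

    log-isReal : ∀ {a} → 0ℚ < a → IsReal (log a)
    log-isReal {a} 0<a = record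
      { lower-inhabited = lower-inh (<-dense 0<a)
      ; upper-inhabited = upper-inh (dense 0<a a<a+1)
      ; lower-closed    = λ {p} {q} p<q → Above-≤ {q} {p} (<⇒≤ p<q)
      ; upper-closed    = λ {p} {q} p<q → Below-≤ {p} {q} 0<a (<⇒≤ p<q)
      ; lower-rounded   = λ {p} → Above-rounded p
      ; upper-rounded   = λ {q} → Below-rounded q 0<a
      ; disjoint        = λ {q} (above , below) → <-irrefl refl (Above-Below {q} {q} above below)
      ; located         = located′
      }
      where
      a<a+1 : a < a + 1ℚ
      a<a+1 = subst (_< a + 1ℚ) (+-identityʳ a) (+-monoʳ-< a 0<1)
      lower-inh : (∃[ v ] 0ℚ < v × v < a) → ∃[ r ] AbovePower u r a
      lower-inh (v , 0<v , v<a) = forget (dense 0<v v<a)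
        where
        forget : (∃[ r ] BelowPower u r v × AbovePower u r a) → ∃[ r ] AbovePower u r a
        forget (r , _ , above) = r , above
      upper-inh : (∃[ r ] BelowPower u r a × AbovePower u r (a + 1ℚ)) → ∃[ r ] BelowPower u r a
      upper-inh (r , below , _) = r , below
      located′ : ∀ {p q} → p < q → AbovePower u p a ⊎ BelowPower u q a
      located′ {p} {q} p<q =
        [ (λ lt → inj₂ (inj₂ lt))
        , (λ ge → inj₁ (0<a , [ (λ lt → lt) , (λ le → ⊥-elim (absurd ge le)) ]′
            (<-≤-connex (u ^ℤ ↥ p) (a ^ℚ ↧ₙ p))))
        ]′ (<-≤-connex (a ^ℚ ↧ₙ q) (u ^ℤ ↥ q))
        where
        absurd : u ^ℤ ↥ q ≤ a ^ℚ ↧ₙ q → a ^ℚ ↧ₙ p ≤ u ^ℤ ↥ p → ⊥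
        absurd ge le = ℤ.<-irrefl refl (ℤ.<-≤-trans (drop-*<* p<q)
          (subst₂ ℤ._≤_ (cong (ℤ._* ↧ p) (ℤ.*-identityʳ (↥ q))) (cong (ℤ._* ↧ q) (ℤ.*-identityʳ (↥ p)))
            (Separation.sep-≤-≤ 0<a 0<a (↥ q) (↥ p) (↧ₙ q) (↧ₙ p) 1 1 ≤-refl ge le)))

  -- Witnesses for products, reciprocals and order-reversing images of cuts.

  lower<upper : ∀ {x} → IsReal x → ∀ {p q} → lower x p → upper x q → p < q
  lower<upper {x} x-real {p} {q} lp uq =
    [ (λ lt → lt) , (λ q≤p → ⊥-elim (absurd q≤p (<-cmp p q))) ]′ (<-≤-connex p q)
    where
    open IsReal x-real
    absurd : q ≤ p → Tri (p < q) (p ≡ q) (q < p) → ⊥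
    absurd q≤p (tri< p<q _ _)  = <-irrefl refl (<-≤-trans p<q q≤p)
    absurd q≤p (tri≈ _ refl _) = disjoint (lp , uq)
    absurd q≤p (tri> _ _ q<p)  = disjoint (lp , upper-closed q<p uq)

  small : ∀ M {ε} → 0ℚ < ε → 0ℚ < M → ∃[ δ ] 0ℚ < δ × M * δ < ε
  small M {ε} 0<ε 0<M = step₁ (inverse 0<M)
    where
    step₁ : (∃[ r ] 0ℚ < r × r * M ≡ 1ℚ) → ∃[ δ ] 0ℚ < δ × M * δ < ε
    step₁ (r , 0<r , rM≡1) = step₂ (<-dense (*-pos {ε} {r} 0<ε 0<r))
      where
      step₂ : (∃[ δ ] 0ℚ < δ × δ < ε * r) → ∃[ δ ] 0ℚ < δ × M * δ < ε
      step₂ (δ , 0<δ , δ<εr) = δ , 0<δ , subst₂ _<_ (*-comm δ M) (*-cancel-inverse ε rM≡1)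
        (*-monoʳ-< {δ} {ε * r} {M} 0<M δ<εr)

  -- Interval multiplication also demands an upper bound `t` of `x` and an open interval around j.
  -- The interval gets a radius δ with |s| δ and |t| δ smaller than the gap s j - r; as s ≤ t and j
  -- ≥ 0, all four products then exceed r.
  lower-*-fromℕ⁺ : ∀ {x r s t} j → lower x s → upper x t → s ≤ t → r < s * ι j →
    lower (x ℝ.* fromℕ j) r
  lower-*-fromℕ⁺ {x} {r} {s} {t} j ls ut s≤t r<sj = step (small M (p<q⇒0<q-p r<sj) 0<M)
    where
    J M ε : ℚ
    J = ι j
    M = ℚ.∣ s ∣ + ℚ.∣ t ∣ + 1ℚ
    ε = s * J - r
    0≤∣s∣+∣t∣ : 0ℚ ≤ ℚ.∣ s ∣ + ℚ.∣ t ∣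
    0≤∣s∣+∣t∣ = +-mono-≤ (0≤∣p∣ s) (0≤∣p∣ t)
    0<M : 0ℚ < M
    0<M = +-mono-≤-< 0≤∣s∣+∣t∣ 0<1
    ∣s∣≤M : ℚ.∣ s ∣ ≤ M
    ∣s∣≤M = subst₂ _≤_ (trans (+-identityʳ _) (+-identityʳ ℚ.∣ s ∣)) refl
      (+-mono-≤ (+-mono-≤ (≤-refl {ℚ.∣ s ∣}) (0≤∣p∣ t)) (<⇒≤ 0<1))
    ∣t∣≤M : ℚ.∣ t ∣ ≤ M
    ∣t∣≤M = subst₂ _≤_ (trans (+-identityʳ _) (+-identityˡ ℚ.∣ t ∣)) refl
      (+-mono-≤ (+-mono-≤ (0≤∣p∣ s) (≤-refl {ℚ.∣ t ∣})) (<⇒≤ 0<1))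
    -y≤∣y∣ : ∀ y → - y ≤ ℚ.∣ y ∣
    -y≤∣y∣ y =
      [ (λ eq → ≤-trans (neg-antimono-≤ (∣p∣≡p⇒0≤p eq)) (0≤∣p∣ y))
      , (λ eq → ≤-reflexive (sym eq))
      ]′ (∣p∣≡p∨∣p∣≡-p y)
    perturb : ∀ {y δ} → s ≤ y → ℚ.∣ y ∣ * ℚ.∣ δ ∣ < ε → r < y * (J + δ)
    perturb {y} {δ} s≤y small-yδ = 0<q-p⇒p<q {r} {y * (J + δ)} (subst (0ℚ <_) (lemma s y J δ r)
      (+-mono-≤-< {0ℚ} {(y - s) * J} {0ℚ} {ε + y * δ}
        (*-nonNeg {y - s} {J} (p≤q⇒0≤q-p s≤y) (ι-mono-≤ {0} {j} z≤n)) pos))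
      where
      lemma : ∀ s y J δ r → (y - s) * J + (s * J - r + y * δ) ≡ y * (J + δ) - r
      lemma = solve-∀ ℚ-ring
      neg-bound : - (y * δ) < ε
      neg-bound = ≤-<-trans (-y≤∣y∣ (y * δ)) (subst (_< ε) (sym (∣p*q∣≡∣p∣*∣q∣ y δ)) small-yδ)
      lemma₂ : ∀ e z → e - - z ≡ e + z
      lemma₂ = solve-∀ ℚ-ring
      pos : 0ℚ < ε + y * δ
      pos = subst (0ℚ <_) (lemma₂ ε (y * δ)) (p<q⇒0<q-p neg-bound)
    step : (∃[ δ ] 0ℚ < δ × M * δ < ε) → lower (x ℝ.* fromℕ j) r
    step (δ , 0<δ , Mδ<ε) = s , t , J - δ , J + δ ,
      (ls , ut , subst (J - δ <_) (+-identityʳ J) (+-monoʳ-< J (neg-antimono-< 0<δ))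
               , subst (_< J + δ) (+-identityʳ J) (+-monoʳ-< J 0<δ)) ,
      (perturb {s} { - δ} ≤-refl (bound ∣s∣≤M ∣-δ∣) , perturb {s} {δ} ≤-refl (bound ∣s∣≤M ∣δ∣) ,
       perturb {t} { - δ} s≤t (bound ∣t∣≤M ∣-δ∣) , perturb {t} {δ} s≤t (bound ∣t∣≤M ∣δ∣))
      where
      ∣δ∣ : ℚ.∣ δ ∣ ≡ δ
      ∣δ∣ = 0≤p⇒∣p∣≡p (<⇒≤ 0<δ)
      ∣-δ∣ : ℚ.∣ - δ ∣ ≡ δ
      ∣-δ∣ = trans (∣-p∣≡∣p∣ δ) ∣δ∣
      bound : ∀ {a d} → a ≤ M → d ≡ δ → a * d < ε
      bound {a} a≤M refl = ≤-<-trans (*-monoʳ-≤ {a} {M} {δ} (<⇒≤ 0<δ) a≤M) Mδ<ε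

  -- Of the products with the lower endpoint `a`, the one to use depends on its sign: a c ≤ a j for
  -- a ≥ 0, and a d ≤ a j for a ≤ 0.
  lower-*-fromℕ⁻ : ∀ {x r} j → lower (x ℝ.* fromℕ j) r → ∃[ s ] lower x s × r < s * ι j
  lower-*-fromℕ⁻ j (a , b , c , d , (la , ub , c<j , j<d) , (r<ac , r<ad , _ , _)) = a , la ,
    [ (λ 0≤a → <-≤-trans r<ac (*-monoˡ-≤ {c} {ι j} {a} 0≤a (<⇒≤ c<j)))
    , (λ a≤0 → <-≤-trans r<ad (*-monoˡ-≤-nonPos a {{ℚ.nonPositive a≤0}} (<⇒≤ j<d)))
    ]′ (≤-total 0ℚ a)

  lower-*-comm : ∀ {x y q} → lower (x ℝ.* y) q → lower (y ℝ.* x) q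
  lower-*-comm {q = q} (a , b , c , d , (la , ub , lc , ud) , (ac , ad , bc , bd)) =
    c , d , a , b , (lc , ud , la , ub) ,
    (subst (q <_) (*-comm a c) ac , subst (q <_) (*-comm b c) bc ,
     subst (q <_) (*-comm a d) ad , subst (q <_) (*-comm b d) bd)

  upper-1-1/ : ∀ b .{{_ : NonZero b}} {q} → 1ℚ - (+ 1 / b) < q → upper (fromℕ 1 ℝ.- fromℕ 1 ℝ./ fromℕ b) q
  upper-1-1/ b {q} lt = step₁ (<-dense lt)
    where
    B Vb : ℚ
    B = ι b
    Vb = + 1 / b
    1≤B : 1ℚ ≤ B
    1≤B = ι-mono-≤ {1} {b} (ℕ.>-nonZero⁻¹ b)
    0<B : 0ℚ < B
    0<B = <-≤-trans 0<1 1≤B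
    recip-lower : ∀ s → s * B < 1ℚ → lower (recip (fromℕ b)) s
    recip-lower s sB<1 =
      [ step
      , (λ s≤0 → B + 1ℚ , subst (_< B + 1ℚ) (+-identityʳ B) (+-monoʳ-< B 0<1) ,
          ≤-<-trans (subst (s * (B + 1ℚ) ≤_) (*-zeroˡ (B + 1ℚ))
            (*-monoʳ-≤ {s} {0ℚ} {B + 1ℚ} (<⇒≤ (+-mono-< 0<B 0<1)) s≤0)) 0<1)
      ]′ (<-≤-connex 0ℚ s)
      where
      step : 0ℚ < s → lower (recip (fromℕ b)) s
      step 0<s = step₂ (inverse 0<s)
        where
        step₂ : (∃[ r ] 0ℚ < r × r * s ≡ 1ℚ) → lower (recip (fromℕ b)) s
        step₂ (r , _ , rs≡1) = step₃ (<-dense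
          (*-cancelʳ-< {B} {r} {s} 0<s (subst₂ _<_ (*-comm s B) (sym rs≡1) sB<1)))
          where
          step₃ : (∃[ e ] B < e × e < r) → lower (recip (fromℕ b)) s
          step₃ (e , B<e , e<r) = e , B<e , subst₂ _<_ (*-comm e s) rs≡1 (*-monoʳ-< {e} {r} {s} 0<s e<r)
    -- A crude upper bound of 1 / b that closes the interval in the product: ½ < 1 ≤ b and 1 < 3 ·
    -- ½.
    three : ℚ
    three = + 3 / 1
    recip-upper : upper (recip (fromℕ b)) three
    recip-upper = ½ , <-≤-trans (*<* (ℤ.+<+ (s≤s (s≤s z≤n)))) 1≤B ,
      *<* (ℤ.+<+ (s≤s z≤n)) , *<* (ℤ.+<+ (s≤s (s≤s (s≤s z≤n))))
    lower-1/ : ∀ v → v < Vb → lower (fromℕ 1 ℝ./ fromℕ b) v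
    lower-1/ v v<V = step (<-dense v<V)
      where
      step : (∃[ s ] v < s × s < Vb) → lower (fromℕ 1 ℝ./ fromℕ b) v
      step (s , v<s , s<V) = lower-*-comm {recip (fromℕ b)} {fromℕ 1}
        (lower-*-fromℕ⁺ {recip (fromℕ b)} {v} {s} {three} 1
        (recip-lower s sB<1) recip-upper s≤3 (subst (v <_) (sym (*-identityʳ s)) v<s))
        where
        sB<1 : s * B < 1ℚ
        sB<1 = subst (s * B <_) (/-*-ι 1 b) (*-monoʳ-< {s} {Vb} {B} 0<B s<V)
        s≤3 : s ≤ three
        s≤3 = [ (λ le → le) , (λ 3≤s → ⊥-elim (<-irrefl refl (<-trans (≤-<-trans
          (subst (_≤ s * B) (*-identityʳ three)
            (≤-trans (*-monoˡ-≤ {1ℚ} {B} {three} (ι-mono-≤ {0} {3} z≤n) 1≤B)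
              (*-monoʳ-≤ {three} {s} {B} (<⇒≤ 0<B) 3≤s)))
          sB<1) (*<* (ℤ.+<+ (s≤s (s≤s z≤n))))))) ]′ (≤-total s three)
    step₁ : (∃[ m ] 1ℚ - Vb < m × m < q) → upper (fromℕ 1 ℝ.- fromℕ 1 ℝ./ fromℕ b) q
    -- The gap q - m is spent on an upper bound of 1; what remains is 1 - m < 1 / b.
    step₁ (m , lt₁ , m<q) = 1ℚ + (q - m) , m - 1ℚ ,
      subst (_< 1ℚ + (q - m)) (+-identityʳ 1ℚ) (+-monoʳ-< 1ℚ (p<q⇒0<q-p m<q)) ,
      lower-1/ (- (m - 1ℚ)) (0<q-p⇒p<q { - (m - 1ℚ)} {Vb} (subst (0ℚ <_) (lemma₁ m Vb) (p<q⇒0<q-p lt₁))) ,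
      lemma₂ q m
      where
      lemma₁ : ∀ m v → m - (1ℚ - v) ≡ v - - (m - 1ℚ)
      lemma₁ = solve-∀ ℚ-ring
      lemma₂ : ∀ q m → q ≡ 1ℚ + (q - m) + (m - 1ℚ)
      lemma₂ = solve-∀ ℚ-ring

  -- The image of `x` under the order-reversing bijection `ψ`, whose inverse is `φ`. It yields -
  -- log_u g / j directly from the cut of log_u g.
  antitone-isReal : ∀ {x} (φ ψ : ℚ → ℚ) → (∀ q → φ (ψ q) ≡ q) → (∀ q → ψ (φ q) ≡ q) →
    (∀ {p q} → p < q → φ q < φ p) → (∀ {p q} → p < q → ψ q < ψ p) → IsReal x →
    IsReal (record { lower = λ q → upper x (φ q) ; upper = λ q → lower x (φ q) })
  antitone-isReal {x} φ ψ φψ ψφ φ-anti ψ-anti x-real = record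
    { lower-inhabited = pull (upper x) upper-inhabited
    ; upper-inhabited = pull (lower x) lower-inhabited
    ; lower-closed    = λ p<q → upper-closed (φ-anti p<q)
    ; upper-closed    = λ p<q → lower-closed (φ-anti p<q)
    ; lower-rounded   = λ {p} h → up p (upper-rounded h)
    ; upper-rounded   = λ {q} h → down q (lower-rounded h)
    ; disjoint        = λ (h₁ , h₂) → disjoint (h₂ , h₁)
    ; located         = λ p<q → [ inj₂ , inj₁ ]′ (located (φ-anti p<q))
    }
    where
    open IsReal x-real
    pull : (P : ℚ → Set) → ∃ P → ∃[ q ] P (φ q)
    pull P (q , h) = ψ q , subst P (sym (φψ q)) h
    up : ∀ p → (∃[ r ] r < φ p × upper x r) → ∃[ q ] p < q × upper x (φ q)
    up p (r , r<φp , h) = ψ r , subst (_< ψ r) (ψφ p) (ψ-anti r<φp) , subst (upper x) (sym (φψ r)) h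
    down : ∀ q → (∃[ r ] φ q < r × lower x r) → ∃[ p ] p < q × lower x (φ p)
    down q (r , φq<r , h) = ψ r , subst (ψ r <_) (ψφ q) (ψ-anti φq<r) , subst (lower x) (sym (φψ r)) h

  -- From the real hypotheses to integer inequalities.

  module Log₂ = Logarithm 2 (s≤s (s≤s z≤n))

  -- The hypotheses 1 ≤ Δ and 1 ≤ K put only the rationals strictly below 1 into the lower cuts, so
  -- 1 has to be approximated by such a c. The larger of 1 - ε and ½ works.
  near-one : ∀ {ε} → 0ℚ < ε → ∃[ c ] 0ℚ < c × c < 1ℚ × 1ℚ - ε ≤ c
  near-one {ε} 0<ε =
    [ (λ ε≤½ → 1ℚ - ε , <-≤-trans 0<½ (½≤ ε≤½) ,
        subst (1ℚ - ε <_) (+-identityʳ 1ℚ) (+-monoʳ-< 1ℚ (neg-antimono-< 0<ε)) , ≤-refl)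
    , (λ ½≤ε → ½ , 0<½ , *<* (ℤ.+<+ (s≤s (s≤s z≤n))) , +-monoʳ-≤ 1ℚ (neg-antimono-≤ ½≤ε))
    ]′ (≤-total ε ½)
    where
    0<½ : 0ℚ < ½
    0<½ = *<* (ℤ.+<+ (s≤s z≤n))
    ½≤ : ε ≤ ½ → ½ ≤ 1ℚ - ε
    ½≤ ε≤½ = +-monoʳ-≤ 1ℚ (neg-antimono-≤ ε≤½)

  module _ (Δ K : ℝ) (1≤Δ : fromℕ 1 ℝ.≤ cut Δ) (1≤K : fromℕ 1 ℝ.≤ cut K) where

    -- This is (K - 1)Δ + 1 ≤ (K - 1)Δ + Δ = KΔ, using Δ ≥ 1. The factors k and c are returned
    -- separately and positive, so that inequalities can be multiplied by them.
    [K-1]Δ+1≤KΔ : ∀ {q} → lower ((cut K ℝ.- fromℕ 1) ℝ.* cut Δ) q →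
      ∃[ k ] ∃[ c ] (lower (cut K) k × lower (cut Δ) c) × (0ℚ < k × 0ℚ < c) × q + 1ℚ ≤ k * c
    [K-1]Δ+1≤KΔ {q}
      (a , _ , c , d , ((a₁ , a₂ , K>a₁ , 1<-a₂ , a≡) , _ , Δ>c , Δ<d) , (q<ac , q<ad , _ , _)) =
      [ positive-case , nonpositive-case ]′ (<-≤-connex 0ℚ a)
      where
      Goal : Set
      Goal = ∃[ k ] ∃[ c ] (lower (cut K) k × lower (cut Δ) c) × (0ℚ < k × 0ℚ < c) × q + 1ℚ ≤ k * c

      1+a<a₁ : 1ℚ + a < a₁
      1+a<a₁ = 0<q-p⇒p<q {1ℚ + a} {a₁} (subst (0ℚ <_)
        (trans (lemma a₁ a₂) (cong (λ x → a₁ - (1ℚ + x)) (sym a≡))) (p<q⇒0<q-p 1<-a₂))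
        where
        lemma : ∀ x y → - y - 1ℚ ≡ x - (1ℚ + (x + y))
        lemma = solve-∀ ℚ-ring

      positive-case : 0ℚ < a → Goal
      positive-case 0<a = step (near-one (p<q⇒0<q-p q<ac))
        where
        ε : ℚ
        -- The surplus pays for replacing 1 by a rational x below Δ with x ≥ 1 - ε and x ≥ c: x + a
        -- x ≥ (1 - ε) + a c = q + 1.
        ε = a * c - q
        finish : ∀ x → lower (cut Δ) x → 0ℚ < x → c ≤ x → 1ℚ - ε ≤ x → Goal
        finish x Δ>x 0<x c≤x 1-ε≤x = 1ℚ + a , x ,
          (IsReal.lower-closed (isReal K) 1+a<a₁ K>a₁ , Δ>x) , (+-mono-< 0<1 0<a , 0<x) ,
          subst₂ _≤_ (lemma₁ (a * c) q) (lemma₂ a x)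
            (+-mono-≤ {1ℚ - ε} {x} {a * c} {a * x} 1-ε≤x (*-monoˡ-≤ {c} {x} {a} (<⇒≤ 0<a) c≤x))
          where
          lemma₁ : ∀ y q → 1ℚ - (y - q) + y ≡ q + 1ℚ
          lemma₁ = solve-∀ ℚ-ring
          lemma₂ : ∀ a x → x + a * x ≡ (1ℚ + a) * x
          lemma₂ = solve-∀ ℚ-ring
        step : (∃[ x ] 0ℚ < x × x < 1ℚ × 1ℚ - ε ≤ x) → Goal
        step (x , 0<x , x<1 , 1-ε≤x) =
          [ (λ c≤x → finish x (1≤Δ x x<1) 0<x c≤x 1-ε≤x)
          , (λ x≤c → finish c Δ>c (<-≤-trans 0<x x≤c) ≤-refl (≤-trans 1-ε≤x x≤c))
          ]′ (≤-total c x)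

      nonpositive-case : a ≤ 0ℚ → Goal
      -- Here q < 0, and both factors can be taken equal to one x < 1 near 1: x² ≥ 2 x - 1 ≥ 1 - 2 ε
      -- ≥ q + 1.
      nonpositive-case a≤0 = step₁ (small (1ℚ + 1ℚ) (neg-antimono-< q<0) (+-mono-< 0<1 0<1))
        where
        0<d : 0ℚ < d
        0<d = lower<upper (isReal Δ) (1≤Δ 0ℚ 0<1) Δ<d
        q<0 : q < 0ℚ
        q<0 = <-≤-trans q<ad (subst (a * d ≤_) (*-zeroˡ d) (*-monoʳ-≤ {a} {0ℚ} {d} (<⇒≤ 0<d) a≤0))
        step₁ : (∃[ ε ] 0ℚ < ε × (1ℚ + 1ℚ) * ε < - q) → Goal
        step₁ (ε , 0<ε , 2ε<-q) = step₂ (near-one 0<ε)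
          where
          step₂ : (∃[ x ] 0ℚ < x × x < 1ℚ × 1ℚ - ε ≤ x) → Goal
          step₂ (x , 0<x , x<1 , 1-ε≤x) = x , x , (1≤K x x<1 , 1≤Δ x x<1) , (0<x , 0<x) ,
            ≤-trans (subst₂ _≤_ (lemma₁ q) refl (+-monoʳ-≤ 1ℚ (neg-antimono-≤ (<⇒≤ 2ε<-q))))
            (≤-trans (subst₂ _≤_ (lemma₂ ε) refl (+-monoˡ-≤ (- 1ℚ) (+-mono-≤ 1-ε≤x 1-ε≤x)))
              (subst₂ _≤_ (+-identityʳ (x + x - 1ℚ)) (lemma₃ x) (+-monoʳ-≤ (x + x - 1ℚ) square)))
            where
            square : 0ℚ ≤ (1ℚ - x) * (1ℚ - x)
            square = *-nonNeg {1ℚ - x} {1ℚ - x} (p≤q⇒0≤q-p (<⇒≤ x<1)) (p≤q⇒0≤q-p (<⇒≤ x<1))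
            lemma₁ : ∀ q → 1ℚ + - (- q) ≡ q + 1ℚ
            lemma₁ = solve-∀ ℚ-ring
            lemma₂ : ∀ ε → 1ℚ - ε + (1ℚ - ε) + - 1ℚ ≡ 1ℚ + - ((1ℚ + 1ℚ) * ε)
            lemma₂ = solve-∀ ℚ-ring
            lemma₃ : ∀ x → x + x - 1ℚ + (1ℚ - x) * (1ℚ - x) ≡ x * x
            lemma₃ = solve-∀ ℚ-ring

    -- The witnesses in the quotient satisfy a < s t, s < N and t e < 1 with e above KΔ, hence a k c
    -- < s t e < s < N. That t and s are positive is recovered from 0 < a.
    lower-N/KΔ : ∀ {N a k c} → lower (fromℕ N ℝ./ (cut K ℝ.* cut Δ)) a → 0ℚ < a →
      lower (cut K) k → lower (cut Δ) c → 0ℚ < k → 0ℚ < c → a * (k * c) < ι N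
    lower-N/KΔ {N} {a} {k} {c}
      (s , s′ , t , _ ,
       (s<N , N<s′ , (e , (_ , k₁ , _ , d₁ , (_ , K<k₁ , _ , Δ<d₁) , (_ , _ , _ , k₁d₁<e)) , te<1) , _) ,
       (a<st , _ , a<s′t , _)) 0<a K>k Δ>c 0<k 0<c = begin-strict
        a * (k * c)      <⟨ *-monoʳ-< {a} {s * t} {k * c} 0<kc a<st ⟩
        s * t * (k * c)  <⟨ *-monoˡ-< {k * c} {e} {s * t} (<-trans 0<a a<st) kc<e ⟩
        s * t * e        ≡⟨ *-assoc s t e ⟩
        s * (t * e)      <⟨ *-monoˡ-< {t * e} {1ℚ} {s} 0<s te<1 ⟩
        s * 1ℚ           ≡⟨ *-identityʳ s ⟩
        s                <⟨ s<N ⟩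
        ι N              ∎
      where
      open ≤-Reasoning
      0<kc : 0ℚ < k * c
      0<kc = *-pos {k} {c} 0<k 0<c
      k<k₁ : k < k₁
      k<k₁ = lower<upper (isReal K) K>k K<k₁
      kc<e : k * c < e
      kc<e = <-trans (*-monoʳ-< {k} {k₁} {c} 0<c k<k₁)
        (<-trans (*-monoˡ-< {c} {d₁} {k₁} (<-trans 0<k k<k₁) (lower<upper (isReal Δ) Δ>c Δ<d₁)) k₁d₁<e)
      0<s′ : 0ℚ < s′
      0<s′ = ≤-<-trans (ι-mono-≤ {0} {N} z≤n) N<s′
      0<t : 0ℚ < t
      0<t = [ (λ lt → lt) , (λ t≤0 → ⊥-elim (<-irrefl refl (<-trans 0<a (<-≤-trans a<s′t
        (subst (s′ * t ≤_) (*-zeroʳ s′) (*-monoˡ-≤ {t} {0ℚ} {s′} (<⇒≤ 0<s′) t≤0)))))) ]′ (<-≤-connex 0ℚ t)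
      0<s : 0ℚ < s
      0<s = *-cancelʳ-< {0ℚ} {s} {t} 0<t (subst (_< s * t) (sym (*-zeroˡ t)) (<-trans 0<a a<st))

    -- If N < (i + 1) 2^b, both factors can be lowered to rationals t < i + 1 and v < 2^b with N < v
    -- t still true. Then t - 1 < i gives t ≤ k c with k below K and c below Δ, and log v < b gives
    -- some a > v below N / (KΔ). So N < v t < a k c < N, a contradiction.
    threshold : ∀ N b i → fromℕ b ℝ.≤ log₂ (fromℕ N ℝ./ (cut K ℝ.* cut Δ)) →
      fromℕ i ℝ.≤ (cut K ℝ.- fromℕ 1) ℝ.* cut Δ → suc i ℕ.* 2 ℕ.^ b ℕ.≤ N
    threshold N b i b≤ i≤ = ℕ.≮⇒≥ absurd
      where
      absurd : N ℕ.< suc i ℕ.* 2 ℕ.^ b → ⊥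
      absurd N<hu = step₁ (*-rounded {ι N} {ι (suc i)} {ι (2 ℕ.^ b)} (ι-mono-≤ {0} {N} z≤n)
          (ι-mono-< {0} {2 ℕ.^ b} (ℕ.m^n>0 2 b))
          (subst (ι N <_) (ι-* (suc i) (2 ℕ.^ b)) (ι-mono-< {N} N<hu)))
        where
        module _ (t : ℚ) (0<t : 0ℚ < t) (v : ℚ) (0<v : 0ℚ < v) (N<vt : ι N < v * t)
          (r : ℚ) (r-below : BelowPower 2 r v) where
          step₅ : ∀ {k c a} → lower (cut K) k → lower (cut Δ) c → 0ℚ < k → 0ℚ < c → t ≤ k * c →
            lower (fromℕ N ℝ./ (cut K ℝ.* cut Δ)) a → AbovePower 2 r a → ⊥
          step₅ {k} {c} {a} K>k Δ>c 0<k 0<c t≤kc la above = <-irrefl refl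
            (<-trans N<vt (<-trans (*-monoʳ-< {v} {a} {t} 0<t (Log₂.Below-Above-base {r} 0<v r-below above))
            (≤-<-trans (*-monoˡ-≤ {t} {k * c} {a} (<⇒≤ (proj₁ above)) t≤kc)
              (lower-N/KΔ {N} {a} {k} {c} la (proj₁ above) K>k Δ>c 0<k 0<c))))
          step₄ : (∃[ k ] ∃[ c ] (lower (cut K) k × lower (cut Δ) c) × (0ℚ < k × 0ℚ < c) ×
              t - 1ℚ + 1ℚ ≤ k * c) →
            lower (log₂ (fromℕ N ℝ./ (cut K ℝ.* cut Δ))) r → ⊥
          step₄ (k , c , (K>k , Δ>c) , (0<k , 0<c) , le) (a , la , above) =
            step₅ K>k Δ>c 0<k 0<c (subst (_≤ k * c) (lemma t) le) la above
            where
            lemma : ∀ t → t - 1ℚ + 1ℚ ≡ t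
            lemma = solve-∀ ℚ-ring
        t-1<i : ∀ {t} → t < ι (suc i) → t - 1ℚ < ι i
        t-1<i {t} lt = subst (t - 1ℚ <_) (trans (cong (_- 1ℚ) (ι-+ 1 i)) (lemma (ι i)))
          (+-monoˡ-< (- 1ℚ) lt)
          where
          lemma : ∀ x → 1ℚ + x - 1ℚ ≡ x
          lemma = solve-∀ ℚ-ring
        v-below : ∀ {v} → 0ℚ < v → v < ι (2 ℕ.^ b) → BelowPower 2 (+ b / 1) v
        v-below {v} 0<v lt = Log₂.Below-/ (+ b) 1 0<v (subst₂ _<_ (sym (*-identityʳ v)) (ι-^ 2 b) lt)
        step₃ : ∀ t → 0ℚ < t → t < ι (suc i) → ∀ v → 0ℚ < v → ι N < v * t →
          (∃[ r ] r < + b / 1 × BelowPower 2 r v) → ⊥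
        step₃ t 0<t t<h v 0<v N<vt (r , r<b , below) = step₄ t 0<t v 0<v N<vt r below
          ([K-1]Δ+1≤KΔ (i≤ (t - 1ℚ) (t-1<i t<h))) (b≤ r r<b)
        step₂ : ∀ t → 0ℚ < t → t < ι (suc i) → (∃[ v ] 0ℚ < v × v < ι (2 ℕ.^ b) × ι N < v * t) → ⊥
        step₂ t 0<t t<h (v , 0<v , v<u , N<vt) =
          step₃ t 0<t t<h v 0<v N<vt (Log₂.Below-rounded (+ b / 1) 0<v (v-below 0<v v<u))
        step₁ : (∃[ t ] 0ℚ < t × t < ι (suc i) × ι N < t * ι (2 ℕ.^ b)) → ⊥
        step₁ (t , 0<t , t<h , N<tu) = step₂ t 0<t t<h
          (*-rounded {ι N} {ι (2 ℕ.^ b)} {t} (ι-mono-≤ {0} {N} z≤n) 0<t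
          (subst (ι N <_) (*-comm t (ι (2 ℕ.^ b))) N<tu))

  -- Cancelling the factor 2 leaves 2^n < S, so log₂ S exceeds n. The length b N is presented as a
  -- successor to make this cancellation possible.
  deficiency≤1 : ∀ n S → 2 ℕ.^ suc n ℕ.< 2 ℕ.* S → fromℕ (suc n) ℝ.- log₂ (fromℕ S) ℝ.≤ fromℕ 1
  deficiency≤1 n S lt q (a , c , a<n , (x , S<x , below) , q≡) = subst₂ _<_ (sym q≡) eq
    (+-mono-< a<n c<-n)
    where
    2^n<x : ι (2 ℕ.^ n) < x
    2^n<x = <-trans (ι-mono-< {2 ℕ.^ n} {S} (ℕ.*-cancelˡ-< 2 (2 ℕ.^ n) S lt)) S<x
    0<x : 0ℚ < x
    0<x = ≤-<-trans (ι-mono-≤ {0} {2 ℕ.^ n} z≤n) 2^n<x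
    above : AbovePower 2 (+ n / 1) x
    above = Log₂.Above-/ (+ n) 1 0<x (subst₂ _<_ (ι-^ 2 n) (sym (*-identityʳ x)) 2^n<x)
    n<-c : ι n < - c
    n<-c = Log₂.Above-Below {+ n / 1} { - c} above below
    c<-n : c < - ι n
    c<-n = subst (_< - ι n) (neg-involutive c) (neg-antimono-< n<-c)
    eq : ι (suc n) + - ι n ≡ 1ℚ
    eq = trans (cong (_+ - ι n) (ι-+ 1 n)) (lemma (ι n))
      where
      lemma : ∀ y → 1ℚ + y + - y ≡ 1ℚ
      lemma = solve-∀ ℚ-ring

  -- The rate determined by a probability g on j coordinates.

  module Rate (u : ℕ) .{{u≢0 : NonZero u}} (1<u : 1 ℕ.< u) {g : ℚ} (0<g : 0ℚ < g)
    (j : ℕ) .{{j≢0 : NonZero j}} where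

    open Powers u 1<u
    open Logarithm u 1<u

    private
      J J⁻¹ : ℚ
      J = ι j
      J⁻¹ = + 1 / j

      J⁻¹J : J⁻¹ * J ≡ 1ℚ
      J⁻¹J = /-*-ι 1 j

      JJ⁻¹ : J * J⁻¹ ≡ 1ℚ
      JJ⁻¹ = trans (*-comm J J⁻¹) J⁻¹J

      0<J : 0ℚ < J
      0<J = ι-mono-< {0} {j} (ℕ.>-nonZero⁻¹ j)

      0<J⁻¹ : 0ℚ < J⁻¹
      0<J⁻¹ = *-cancelʳ-< {0ℚ} {J⁻¹} {J} 0<J (subst₂ _<_ (sym (*-zeroˡ J)) (sym J⁻¹J) 0<1)

      φ ψ : ℚ → ℚ
      φ q = - (q * J)
      ψ q = - (q * J⁻¹)

      neg-cancel : ∀ {x y} → x * y ≡ 1ℚ → ∀ q → - (- (q * x) * y) ≡ q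
      neg-cancel {x} {y} xy≡1 q = trans (lemma q x y) (trans (cong (q *_) xy≡1) (*-identityʳ q))
        where
        lemma : ∀ q x y → - (- (q * x) * y) ≡ q * (x * y)
        lemma = solve-∀ ℚ-ring

      φ-anti : ∀ {p q} → p < q → φ q < φ p
      φ-anti {p} {q} p<q = neg-antimono-< (*-monoʳ-< {p} {q} {J} 0<J p<q)

      ψ-anti : ∀ {p q} → p < q → ψ q < ψ p
      ψ-anti {p} {q} p<q = neg-antimono-< (*-monoʳ-< {p} {q} {J⁻¹} 0<J⁻¹ p<q)

    -- The real number - log_u g / j.
    rate : ℝ
    rate = mkℝ _ (antitone-isReal φ ψ (neg-cancel J⁻¹J) (neg-cancel JJ⁻¹) (λ {p} {q} → φ-anti {p} {q})
      (λ {p} {q} → ψ-anti {p} {q}) (log-isReal 0<g))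

    private
      φ-neg : ∀ s → - (- s * J) ≡ s * J
      φ-neg = lemma J
        where
        lemma : ∀ J s → - (- s * J) ≡ s * J
        lemma = solve-∀ ℚ-ring

      lower-neg-rate : ∀ s → AbovePower u (s * J) g → lower (ℝ.- cut rate) s
      lower-neg-rate s = subst (λ r → AbovePower u r g) (sym (φ-neg s))

      module R = IsReal (isReal rate)

      upper-neg-rate : ∃[ t ] upper (ℝ.- cut rate) t
      upper-neg-rate = negate R.lower-inhabited
        where
        negate : ∃ (lower (cut rate)) → ∃[ t ] upper (ℝ.- cut rate) t
        negate (t , h) = - t , subst (lower (cut rate)) (sym (neg-involutive t)) h

      lower-neg-rate* : ∀ {r s} k → AbovePower u (s * J) g → r < s * ι k →
        lower (ℝ.- cut rate ℝ.* fromℕ k) r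
      lower-neg-rate* {r} {s} k above r<sk = step upper-neg-rate
        where
        step : (∃[ t ] upper (ℝ.- cut rate) t) → lower (ℝ.- cut rate ℝ.* fromℕ k) r
        step (t , ut) = lower-*-fromℕ⁺ {ℝ.- cut rate} {r} {s} {t} k (lower-neg-rate s above) ut s≤t r<sk
          where
          t<s : - t < - s
          t<s = lower<upper (isReal rate) ut (lower-neg-rate s above)
          s≤t : s ≤ t
          s≤t = subst₂ _≤_ (neg-involutive s) (neg-involutive t) (neg-antimono-≤ (<⇒≤ t<s))

      lower-neg-rate-inhabited : ∃[ s ] AbovePower u (s * J) g
      lower-neg-rate-inhabited = step (IsReal.lower-inhabited (log-isReal 0<g))
        where
        step : (∃[ r ] AbovePower u r g) → ∃[ s ] AbovePower u (s * J) g
        step (r , above) = r * J⁻¹ , subst (λ r → AbovePower u r g)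
          (sym (*-cancel-inverse r J⁻¹J)) above

    -- The hypothesis says log f ≤ k (log g) / j, which is - `rate` times k. For 0 < v < f,
    -- rationals r < r′ between log v and log f supply the exponent, with r′ / k as a lower bound of
    -- - `rate`.
    rate-bound : ∀ {f} k → f ^ℚ j ≤ g ^ℚ k → fromℚ f ℝ.≤ u ℝ.^ (ℝ.- cut rate ℝ.* fromℕ k)
    rate-bound {f} k f^j≤g^k v v<f = [ positive-case , nonpositive-case ]′ (<-≤-connex 0ℚ v)
      where
      Goal : Set
      Goal = lower (u ℝ.^ (ℝ.- cut rate ℝ.* fromℕ k)) v
      nonpositive-case : v ≤ 0ℚ → Goal
      nonpositive-case v≤0 = step lower-neg-rate-inhabited
        where
        step : (∃[ s ] AbovePower u (s * J) g) → Goal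
        step (s , above) = s * ι k - 1ℚ , lower-neg-rate* {s * ι k - 1ℚ} {s} k above
          (subst (s * ι k - 1ℚ <_) (+-identityʳ (s * ι k)) (+-monoʳ-< (s * ι k) (neg-antimono-< 0<1))) ,
          inj₁ v≤0
      positive-case : 0ℚ < v → Goal
      positive-case 0<v = step₁ (dense 0<v v<f)
        where
        in-lower : ∀ {r r′} → r < r′ → AbovePower u r′ f → ∀ k → f ^ℚ j ≤ g ^ℚ k →
          lower (ℝ.- cut rate ℝ.* fromℕ k) r
        -- Division by k is impossible for k = 0. Then f^j ≤ 1 forces r′ < 0, and any lower bound s′
        -- of - `rate` will do because s′ · 0 = 0.
        in-lower {r} {r′} r<r′ above zero le =
          step (IsReal.upper-inhabited (log-isReal 0<g)) lower-neg-rate-inhabited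
          where
          step : (∃[ s ] BelowPower u s g) → (∃[ s ] AbovePower u (s * J) g) →
            lower (ℝ.- cut rate ℝ.* fromℕ 0) r
          step (s , below) (s′ , above′) = lower-neg-rate* {r} {s′} 0 above′
            (subst (r <_) (sym (*-zeroʳ s′)) (<-trans r<r′ r′<0))
            where
            r′J<0 : r′ * J < 0ℚ * J
            r′J<0 = subst (r′ * J <_) (trans (*-zeroʳ s) (sym (*-zeroˡ J)))
              (Above-cancel {r′} {s} j 0 above 0<g le (<⇒≤ (Below-pos {s} 0<g below)))
            r′<0 : r′ < 0ℚ
            r′<0 = *-cancelʳ-< {r′} {0ℚ} {J} 0<J r′J<0
        in-lower {r} {r′} r<r′ above k@(suc _) le = lower-neg-rate* {r} {s} k
          (Above-mono {r′} {s * J} {f} {g} j k 0<g le (≤-reflexive eq₁) above)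
          (subst (r <_) (sym eq₂) r<r′)
          where
          s : ℚ
          s = r′ * (+ 1 / k)
          eq₂ : s * ι k ≡ r′
          eq₂ = *-cancel-inverse r′ (/-*-ι 1 k)
          eq₁ : s * J * ι k ≡ r′ * J
          eq₁ = trans (lemma s J (ι k)) (cong (_* J) eq₂)
            where
            lemma : ∀ x y z → x * y * z ≡ x * z * y
            lemma = solve-∀ ℚ-ring
        step₂ : ∀ {r} → BelowPower u r v → (∃[ r′ ] r < r′ × AbovePower u r′ f) → Goal
        step₂ {r} below (r′ , r<r′ , above) = r , in-lower {r} {r′} r<r′ above k f^j≤g^k , below
        step₁ : (∃[ r ] BelowPower u r v × AbovePower u r f) → Goal
        step₁ (r , below , above) = step₂ {r} below (Above-rounded r above)

    -- For q below τ pick q₁ strictly between q and τ. If log g exceeded - q₁ j, so would log v for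
    -- some v < g; but the bound at v places log v below - τ j, which is below - q₁ j. Locatedness
    -- of log g then leaves log g < - q j.
    rate-greatest : ∀ τ → fromℚ g ℝ.≤ u ℝ.^ (ℝ.- cut τ ℝ.* fromℕ j) → cut τ ℝ.≤ cut rate
    rate-greatest τ bound q lq = step₁ (T.lower-rounded lq)
      where
      module T = IsReal (isReal τ)
      step₃ : ∀ q₁ → lower (cut τ) q₁ → (∃[ v ] v < g × AbovePower u (φ q₁) v) → ⊥
      step₃ q₁ lq₁ (v , v<g , above) = step₄ (bound v v<g)
        where
        step₅ : ∀ {r} → BelowPower u r v → (∃[ s ] lower (ℝ.- cut τ) s × r < s * J) → ⊥
        step₅ {r} below (s , ls , r<sJ) = <-irrefl refl (<-trans
          (Above-Below {φ q₁} {r} above below) (<-trans r<sJ sJ<φq₁))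
          where
          sJ<φq₁ : s * J < φ q₁
          sJ<φq₁ = subst (_< φ q₁) (φ-neg s) (φ-anti {q₁} { - s} (lower<upper (isReal τ) lq₁ ls))
        step₄ : lower (u ℝ.^ (ℝ.- cut τ ℝ.* fromℕ j)) v → ⊥
        step₄ (r , lr , below) = step₅ {r} below (lower-*-fromℕ⁻ {ℝ.- cut τ} {r} j lr)
      step₂ : ∀ q₁ → lower (cut τ) q₁ → AbovePower u (φ q₁) g → BelowPower u (φ q) g
      step₂ q₁ lq₁ above = ⊥-elim (step₃ q₁ lq₁ (Above-rounded-base (φ q₁) above))
      step₁ : (∃[ q₁ ] q < q₁ × lower (cut τ) q₁) → BelowPower u (φ q) g
      step₁ (q₁ , q<q₁ , lq₁) = [ step₂ q₁ lq₁ , (λ below → below) ]′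
        (IsReal.located (log-isReal 0<g) {φ q₁} {φ q} (φ-anti {q} {q₁} q<q₁))

  -- Maximising Pr[y_J = α]^(1/|J|).

  open CommutativeExp (CommutativeRing.commutativeSemiring +-*-commutativeRing) using (^-distrib-*)

  -- For nonzero degrees, a^l ≤ b^k encodes a^(1/k) ≤ b^(1/l). Transitivity of this comparison of
  -- roots follows by raising both hypotheses to a common power and cancelling l.
  ≼-trans : ∀ {a b c} k l m .{{_ : NonZero l}} → 0ℚ < a → 0ℚ < b → 0ℚ < c →
    a ^ℚ l ≤ b ^ℚ k → b ^ℚ m ≤ c ^ℚ l → a ^ℚ m ≤ c ^ℚ k
  ≼-trans {a} {b} {c} k l m 0<a 0<b 0<c ab bc = ^-cancel-≤ l (^-pos k 0<c) (begin
    (a ^ℚ m) ^ℚ l  ≡⟨ ^-assoc-comm a m l ⟩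
    (a ^ℚ l) ^ℚ m  ≤⟨ ^-mono-≤ m (<⇒≤ (^-pos l 0<a)) ab ⟩
    (b ^ℚ k) ^ℚ m  ≡⟨ ^-assoc-comm b k m ⟩
    (b ^ℚ m) ^ℚ k  ≤⟨ ^-mono-≤ k (<⇒≤ (^-pos m 0<b)) bc ⟩
    (c ^ℚ l) ^ℚ k  ≡⟨ ^-assoc-comm c l k ⟩
    (c ^ℚ k) ^ℚ l  ∎)
    where open ≤-Reasoning

  maximal-root : {A : Set} (f : A → ℚ) (k : A → ℕ) (x : A) (xs : List A) →
    (∀ {y} → y ∈ x ∷ xs → 0ℚ < f y × NonZero (k y)) →
    ∃[ m ] m ∈ x ∷ xs × (∀ {y} → y ∈ x ∷ xs → f y ^ℚ k m ≤ f m ^ℚ k y)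
  maximal-root f k x []       _   = x , here refl , λ { (here refl) → ≤-refl }
  maximal-root {A} f k x (z ∷ zs) pos = extend (maximal-root f k z zs (λ y∈ → pos (there y∈)))
    where
    Goal : Set
    Goal = ∃[ m ] m ∈ x ∷ z ∷ zs × (∀ {y} → y ∈ x ∷ z ∷ zs → f y ^ℚ k m ≤ f m ^ℚ k y)
    extend : (∃[ m ] m ∈ z ∷ zs × (∀ {y} → y ∈ z ∷ zs → f y ^ℚ k m ≤ f m ^ℚ k y)) → Goal
    extend (m , m∈ , max) = [ keep , replace ]′ (≤-total (f x ^ℚ k m) (f m ^ℚ k x))
      where
      keep : f x ^ℚ k m ≤ f m ^ℚ k x → Goal
      keep le = m , there m∈ , λ { (here refl) → le ; (there y∈) → max y∈ }
      replace : f m ^ℚ k x ≤ f x ^ℚ k m → Goal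
      replace le = x , here refl , λ
        { (here refl) → ≤-refl
        ; {y} (there y∈) → ≼-trans (k y) (k m) (k x) {{proj₂ (pos (there m∈))}}
            (proj₁ (pos (there y∈))) (proj₁ (pos (there m∈))) (proj₁ (pos (here refl))) (max y∈) le }

  subsets : ∀ n → List (Subset n)
  subsets zero    = [] ∷ []
  subsets (suc n) = map (inside ∷_) (subsets n) ++ map (outside ∷_) (subsets n)

  ∈-subsets : ∀ {n} (J : Subset n) → J ∈ subsets n
  ∈-subsets []            = here refl
  ∈-subsets (inside ∷ J)  = ∈-++⁺ˡ (∈-map⁺ _ (∈-subsets J))
  ∈-subsets (outside ∷ J) = ∈-++⁺ʳ _ (∈-map⁺ _ (∈-subsets J))

  module _ {N b : ℕ} (Y : FinSet⁺ (Vec (Block b) N)) where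

    private
      instance
        size≢0 : NonZero (size Y)
        size≢0 = nonEmpty Y

    count : ∀ J → Block b ^ˢ J → ℕ
    count J α = length (filter (agree? J α) (elements Y))

    Pr-*-size : ∀ J α → Pr Y (agree? J α) * ι (size Y) ≡ ι (count J α)
    Pr-*-size J α = /-*-ι (count J α) (size Y)

    0<size : 0ℚ < ι (size Y)
    0<size = ι-mono-< {0} {size Y} (ℕ.>-nonZero⁻¹ (size Y))

    Pr≤1 : ∀ J α → Pr Y (agree? J α) ≤ 1ℚ
    Pr≤1 J α = *-cancelʳ-≤-pos (ι (size Y)) {{positive 0<size}}
      (subst₂ _≤_ (sym (Pr-*-size J α)) (sym (*-identityˡ (ι (size Y))))
        (ι-mono-≤ {count J α} {size Y} (length-filter (agree? J α) (elements Y))))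

    Pr-restrict>0 : ∀ J {x} → x ∈ˢ Y → 0ℚ < Pr Y (agree? J (restrict x J))
    Pr-restrict>0 J {x} x∈Y = *-cancelʳ-< {0ℚ} {Pr Y (agree? J (restrict x J))} {ι (size Y)} 0<size
      (subst₂ _<_ (sym (*-zeroˡ (ι (size Y)))) (sym (Pr-*-size J (restrict x J)))
        (ι-mono-< {0} {count J (restrict x J)}
          (nonempty (∈-filter⁺ (agree? J (restrict x J)) x∈Y (λ _ _ → refl)))))
      where
      nonempty : ∀ {A : Set} {y : A} {ys} → y ∈ ys → 0 ℕ.< length ys
      nonempty (here _)  = s≤s z≤n
      nonempty (there _) = s≤s z≤n

    -- Reduces the functions `α` to finitely many candidates: an assignment of nonzero probability
    -- has the same probability as the restriction of some element of Y.
    Pr-occurs : ∀ J α → Pr Y (agree? J α) ≡ 0ℚ ⊎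
      (∃[ x ] x ∈ˢ Y × Pr Y (agree? J α) ≡ Pr Y (agree? J (restrict x J)))
    Pr-occurs J α = cases (filter (agree? J α) (elements Y)) refl
      where
      cases : ∀ l → filter (agree? J α) (elements Y) ≡ l → Pr Y (agree? J α) ≡ 0ℚ ⊎
        (∃[ x ] x ∈ˢ Y × Pr Y (agree? J α) ≡ Pr Y (agree? J (restrict x J)))
      cases []      eq = inj₁ (trans (cong (λ l → + length l / size Y) eq) (0/n≡0 (size Y)))
      cases (x ∷ _) eq = occurs
        (∈-filter⁻ (agree? J α) {xs = elements Y} (subst (x ∈_) (sym eq) (here refl)))
        where
        occurs : x ∈ˢ Y × restrict x J ≈ α → _
        occurs (x∈Y , x≈α) = inj₂ (x , x∈Y , cong (λ l → + length l / size Y)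
          (filter-≐ (agree? J α) (agree? J (restrict x J))
            ((λ y≈α i i∈J → trans (y≈α i i∈J) (sym (x≈α i i∈J))) ,
             (λ y≈x i i∈J → trans (y≈x i i∈J) (x≈α i i∈J))) (elements Y)))

    record Extremal : Set where
      field
        J*        : Subset N
        x*        : Vec (Block b) N
        J*≢∅      : NonZero ∣ J* ∣
        x*∈Y      : x* ∈ˢ Y
        dominates : ∀ J α → Pr Y (agree? J α) ^ℚ ∣ J* ∣ ≤ Pr Y (agree? J* (restrict x* J*)) ^ℚ ∣ J ∣

    extremal : .{{_ : NonZero N}} → Extremal
    extremal = start (elements Y) refl
      where
      A : Set
      A = Subset N × Vec (Block b) N
      prob : A → ℚ
      prob (J , x) = Pr Y (agree? J (restrict x J))
      dim : A → ℕ
      dim (J , _) = ∣ J ∣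
      candidates : List A
      -- Empty J are excluded, since the comparison of roots is transitive only for nonzero degrees.
      candidates = filter (λ z → 1 ℕ.≤? dim z) (cartesianProduct (subsets N) (elements Y))
      ∈-candidates : ∀ {J x} → x ∈ˢ Y → 1 ℕ.≤ ∣ J ∣ → (J , x) ∈ candidates
      ∈-candidates {J} x∈Y = ∈-filter⁺ (λ z → 1 ℕ.≤? dim z) (∈-cartesianProduct⁺ (∈-subsets J) x∈Y)
      candidates-∈ : ∀ {z} → z ∈ candidates → proj₂ z ∈ˢ Y × NonZero (dim z)
      candidates-∈ {z} z∈ = split
        (∈-filter⁻ (λ z → 1 ℕ.≤? dim z) {xs = cartesianProduct (subsets N) (elements Y)} z∈)
        where
        split : z ∈ cartesianProduct (subsets N) (elements Y) × 1 ℕ.≤ dim z → proj₂ z ∈ˢ Y × NonZero (dim z)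
        split (z∈′ , 1≤) = proj₂ (∈-cartesianProduct⁻ (subsets N) (elements Y) z∈′) , ℕ.>-nonZero 1≤
      HasMaximum : List A → Set
      HasMaximum l = ∃[ m ] m ∈ l × (∀ {z} → z ∈ l → prob z ^ℚ dim m ≤ prob m ^ℚ dim z)
      package : HasMaximum candidates → Extremal
      package ((J* , x*) , m∈ , max) = record
        { J* = J* ; x* = x* ; J*≢∅ = proj₂ (candidates-∈ m∈) ; x*∈Y = proj₁ (candidates-∈ m∈)
        ; dominates = λ J α → dominates J α (ℕ.m≤n⇒m<n∨m≡n {0} {∣ J ∣} z≤n) }
        where
        g : ℚ
        g = prob (J* , x*)
        instance
          J*≢∅ : NonZero ∣ J* ∣
          J*≢∅ = proj₂ (candidates-∈ m∈)
        0<g : 0ℚ < g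
        0<g = Pr-restrict>0 J* (proj₁ (candidates-∈ m∈))
        0^ : ∀ n .{{_ : NonZero n}} → 0ℚ ^ℚ n ≡ 0ℚ
        0^ (suc n) = *-zeroˡ (0ℚ ^ℚ n)
        0≤Pr : ∀ J α → 0ℚ ≤ Pr Y (agree? J α)
        0≤Pr J α = [ (λ eq → ≤-reflexive (sym eq))
          , (λ (x , x∈Y , eq) → subst (0ℚ ≤_) (sym eq) (<⇒≤ (Pr-restrict>0 J x∈Y))) ]′ (Pr-occurs J α)
        dominates : ∀ J α → 0 ℕ.< ∣ J ∣ ⊎ 0 ≡ ∣ J ∣ → Pr Y (agree? J α) ^ℚ ∣ J* ∣ ≤ g ^ℚ ∣ J ∣
        -- For J = ∅ the right-hand side is g^0 = 1, and the bound is just that a probability is at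
        -- most 1.
        dominates J α (inj₂ eq) = subst₂ (λ k y → Pr Y (agree? J α) ^ℚ ∣ J* ∣ ≤ y) eq
          (trans (1^ ∣ J* ∣) (cong (g ^ℚ_) eq)) (^-mono-≤ ∣ J* ∣ (0≤Pr J α) (Pr≤1 J α))
        dominates J α (inj₁ 0<J) =
          [ (λ eq → subst (_≤ g ^ℚ ∣ J ∣) (sym (trans (cong (_^ℚ ∣ J* ∣) eq) (0^ ∣ J* ∣)))
            (<⇒≤ (^-pos ∣ J ∣ 0<g)))
          , (λ (x , x∈Y , eq) → subst (λ y → y ^ℚ ∣ J* ∣ ≤ g ^ℚ ∣ J ∣) (sym eq)
              (max (∈-candidates {J} {x} x∈Y 0<J)))
          ]′ (Pr-occurs J α)
      choose : ∀ l → l ≡ candidates → (∃[ z ] z ∈ candidates) → Extremal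
      choose []      eq   (z , z∈) = ⊥-elim (¬Any[] (subst (z ∈_) (sym eq) z∈))
      choose (z ∷ l) eq   _ = package (subst HasMaximum eq
        (maximal-root prob dim z l λ {y} y∈ → good {y} (candidates-∈ (subst (y ∈_) eq y∈))))
        where
        good : ∀ {z} → proj₂ z ∈ˢ Y × NonZero (dim z) → 0ℚ < prob z × NonZero (dim z)
        good {J , x} (x∈Y , J≢∅) = Pr-restrict>0 J x∈Y , J≢∅
      start : ∀ l → l ≡ elements Y → Extremal
      start []      eq = ⊥-elim (ℕ.<-irrefl refl
        (subst (λ l → 0 ℕ.< length l) (sym eq) (ℕ.>-nonZero⁻¹ (size Y))))
      start (x ∷ _) eq = choose candidates refl
        ((⊤ , x) , ∈-candidates {⊤} {x} (subst (x ∈_) eq (here refl))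
        (subst (1 ℕ.≤_) (sym (∣⊤∣≡n N)) (ℕ.>-nonZero⁻¹ N)))

  -- The lower bound 1 - 1/b for the rate.

  /1-neg : ∀ n → (ℤ.- (+ n)) / 1 ≡ - ι n
  /1-neg zero    = refl
  /1-neg (suc n) = refl

  module _ (b : ℕ) .{{_ : NonZero b}} where

    private
      instance
        2^b≢0 : NonZero (2 ℕ.^ b)
        2^b≢0 = ℕ.m^n≢0 2 b

    1<2^b : 1 ℕ.< 2 ℕ.^ b
    1<2^b = ℕ.^-monoʳ-< 2 (s≤s (s≤s z≤n)) (ℕ.>-nonZero⁻¹ b)

    open Powers (2 ℕ.^ b) 1<2^b using (^ℤ-+; 1<U; 0<U) renaming (U to 2ᵇ)
    open Logarithm (2 ℕ.^ b) 1<2^b using (Below-/)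

    -- g < 2 u^(-j) gives g < u^(-(1 - 1/b) j), because 2 = u^(1/b) ≤ u^(j/b).
    below-1-1/b : ∀ {g} j .{{_ : NonZero j}} → 0ℚ < g → g * 2ᵇ ^ℚ j < ι 2 →
      BelowPower (2 ℕ.^ b) (- ((1ℚ - (+ 1 / b)) * ι j)) g
    below-1-1/b {g} j 0<g lt = subst (λ r → BelowPower (2 ℕ.^ b) r g) eq (Below-/ p b 0<g
      (*-cancelʳ-< {g ^ℚ b} {(2 ℕ.^ b) ^ℤ p} {2ᵇ ^ℚ (j ℕ.* b)} (^-pos (j ℕ.* b) 0<U) (begin-strict
        g ^ℚ b * 2ᵇ ^ℚ (j ℕ.* b)     ≡⟨ cong (g ^ℚ b *_) (^ℚ.^-assocʳ 2ᵇ j b) ⟨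
        g ^ℚ b * (2ᵇ ^ℚ j) ^ℚ b      ≡⟨ ^-distrib-* g (2ᵇ ^ℚ j) b ⟨
        (g * 2ᵇ ^ℚ j) ^ℚ b           <⟨ ^-mono-< b (*-pos {g} {2ᵇ ^ℚ j} 0<g (^-pos j 0<U)) lt ⟩
        ι 2 ^ℚ b                     ≡⟨ ι-^ 2 b ⟨
        2ᵇ                           ≤⟨ 2ᵇ≤ j ⟩
        2ᵇ ^ℚ j                      ≡⟨⟩
        (2 ℕ.^ b) ^ℤ (+ j)           ≡⟨ cong ((2 ℕ.^ b) ^ℤ_) p+jb ⟨
        (2 ℕ.^ b) ^ℤ (+ (j ℕ.* b) ℤ.+ p)     ≡⟨ ^ℤ-+ p (j ℕ.* b) ⟩
        2ᵇ ^ℚ (j ℕ.* b) * (2 ℕ.^ b) ^ℤ p     ≡⟨ *-comm (2ᵇ ^ℚ (j ℕ.* b)) _ ⟩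
        (2 ℕ.^ b) ^ℤ p * 2ᵇ ^ℚ (j ℕ.* b)     ∎)))
      where
      open ≤-Reasoning
      p : ℤ
      p = + j ℤ.+ ℤ.- (+ (j ℕ.* b))
      p+jb : + (j ℕ.* b) ℤ.+ p ≡ + j
      p+jb = lemma (+ (j ℕ.* b)) (+ j)
        where
        lemma : ∀ x y → x ℤ.+ (y ℤ.+ ℤ.- x) ≡ y
        lemma = ℤ-Solver.solve-∀
      2ᵇ≤ : ∀ j .{{_ : NonZero j}} → 2ᵇ ≤ 2ᵇ ^ℚ j
      2ᵇ≤ (suc k) = subst (_≤ 2ᵇ ^ℚ suc k) (*-identityʳ 2ᵇ) (*-monoˡ-≤ {1ℚ} {2ᵇ ^ℚ k} {2ᵇ} (<⇒≤ 0<U)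
        (subst (_≤ 2ᵇ ^ℚ k) (1^ k) (^-mono-≤ k (<⇒≤ 0<1) (<⇒≤ 1<U))))
      eq : p / b ≡ - ((1ℚ - (+ 1 / b)) * ι j)
      eq = begin-equality
        p / b                       ≡⟨ /-≡ p (p ℤ.* + 1) b (1 ℕ.* b) {{_}} {{ℕ.m*n≢0 1 b}} cross ⟩
        _/_ (p ℤ.* + 1) (1 ℕ.* b) {{ℕ.m*n≢0 1 b}}   ≡⟨ /-* p (+ 1) 1 b ⟨
        (p / 1) * V                 ≡⟨ cong (_* V) (/1-+ (+ j) (ℤ.- (+ (j ℕ.* b)))) ⟩
        (ι j + (ℤ.- (+ (j ℕ.* b))) / 1) * V   ≡⟨ cong (λ x → (ι j + x) * V) (/1-neg (j ℕ.* b)) ⟩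
        (ι j - ι (j ℕ.* b)) * V     ≡⟨ cong (λ x → (ι j - x) * V) (ι-* j b) ⟩
        (ι j - ι j * B) * V         ≡⟨ lemma (ι j) B V ⟩
        ι j * V - ι j * (V * B)     ≡⟨ cong (λ x → ι j * V - ι j * x) (/-*-ι 1 b) ⟩
        ι j * V - ι j * 1ℚ          ≡⟨ lemma₂ (ι j) V ⟩
        - ((1ℚ - V) * ι j)          ∎
        where
        B V : ℚ
        B = ι b
        V = + 1 / b
        cross : p ℤ.* + (1 ℕ.* b) ≡ p ℤ.* + 1 ℤ.* + b
        cross = trans (cong (λ k → p ℤ.* + k) (ℕ.*-identityˡ b)) (cong (ℤ._* + b) (sym (ℤ.*-identityʳ p)))
        lemma : ∀ x y z → (x - x * y) * z ≡ x * z - x * (z * y)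
        lemma = solve-∀ ℚ-ring
        lemma₂ : ∀ x z → x * z - x * 1ℚ ≡ - ((1ℚ - z) * x)
        lemma₂ = solve-∀ ℚ-ring

  -- The set Y and its properties.

  module Construction (N b : ℕ) .{{_ : NonZero N}} .{{_ : NonZero b}} where

    private
      u : ℕ
      u = 2 ℕ.^ b

      instance
        u≢0 : NonZero u
        u≢0 = ℕ.m^n≢0 2 b

      m : ℕ
      m = N ℕ./ u

      majority : u ℕ.^ N ℕ.< 2 ℕ.* length (words b N m)
      majority = words-majority b N

    Y : FinSet⁺ (Vec (Block b) N)
    Y = record
      { elements = words b N m
      ; unique   = words-unique b N m
      ; nonEmpty = ℕ.≢-nonZero λ eq → ℕ.n≮0 (subst (λ l → u ℕ.^ N ℕ.< 2 ℕ.* l) eq majority)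
      }

    Y-deficiency : entropyDeficiency Y ℝ.≤ fromℕ 1
    Y-deficiency = at (b ℕ.* N) refl (ℕ.m*n≢0 b N)
      where
      at : ∀ n → n ≡ b ℕ.* N → NonZero n → fromℕ n ℝ.- log₂ (fromℕ (size Y)) ℝ.≤ fromℕ 1
      at (suc n) eq _ = deficiency≤1 n (size Y) (subst (ℕ._< 2 ℕ.* size Y)
        (trans (ℕ.^-*-assoc 2 b N) (cong (2 ℕ.^_) (sym eq))) majority)

    private
      open Extremal (extremal Y)

      instance
        ∣J*∣≢0 : NonZero ∣ J* ∣
        ∣J*∣≢0 = J*≢∅

      g : ℚ
      g = Pr Y (agree? J* (restrict x* J*))

      0<g : 0ℚ < g
      0<g = Pr-restrict>0 Y J* x*∈Y

      open Rate u (1<2^b b) 0<g ∣ J* ∣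

      -- With c the number of elements of Y that agree with `x*` on `J*`, divide c u^|J*| ≤ u^N < 2
      -- |Y| by |Y|.
      g-small : g * ι u ^ℚ ∣ J* ∣ < ι 2
      g-small = *-cancelʳ-< {g * ι u ^ℚ ∣ J* ∣} {ι 2} {ι (size Y)} (0<size Y) (begin-strict
        g * ι u ^ℚ ∣ J* ∣ * ι (size Y)   ≡⟨ lemma g (ι u ^ℚ ∣ J* ∣) (ι (size Y)) ⟩
        g * ι (size Y) * ι u ^ℚ ∣ J* ∣   ≡⟨ cong₂ _*_ (Pr-*-size Y J* (restrict x* J*))
                                                   (sym (ι-^ u ∣ J* ∣)) ⟩
        ι c * ι (u ℕ.^ ∣ J* ∣)           ≡⟨ ι-* c (u ℕ.^ ∣ J* ∣) ⟨
        ι (c ℕ.* u ℕ.^ ∣ J* ∣)           <⟨ ι-mono-< {c ℕ.* u ℕ.^ ∣ J* ∣} {2 ℕ.* size Y} few ⟩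
        ι (2 ℕ.* size Y)                 ≡⟨ ι-* 2 (size Y) ⟩
        ι 2 * ι (size Y)                 ∎)
        where
        open ≤-Reasoning
        c : ℕ
        c = count Y J* (restrict x* J*)
        few : c ℕ.* u ℕ.^ ∣ J* ∣ ℕ.< 2 ℕ.* size Y
        few = ℕ.≤-<-trans (agree-bound (elements Y) (words-unique b N m) J* (restrict x* J*)) majority
        lemma : ∀ x y z → x * y * z ≡ x * z * y
        lemma = solve-∀ ℚ-ring

    Y-rate : ℝ
    Y-rate = rate

    Y-rate-isMinEntropyRate : IsMinEntropyRate Y Y-rate
    Y-rate-isMinEntropyRate =
      (λ J α → rate-bound ∣ J ∣ (dominates J α)) ,
      (λ τ τ-bound → rate-greatest τ (τ-bound J* (restrict x* J*)))

    -- The rational 1 - 1/b lies in the lower cut of the rate, and roundedness yields a rational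
    -- strictly between the two.
    1-1/b<Y-rate : fromℕ 1 ℝ.- fromℕ 1 ℝ./ fromℕ b ℝ.< cut Y-rate
    1-1/b<Y-rate = above (IsReal.lower-rounded (isReal rate) {1ℚ - (+ 1 / b)}
      (below-1-1/b b ∣ J* ∣ 0<g g-small))
      where
      above : (∃[ q ] 1ℚ - (+ 1 / b) < q × lower (cut rate) q) →
        fromℕ 1 ℝ.- fromℕ 1 ℝ./ fromℕ b ℝ.< cut rate
      above (q , lt , lq) = q , upper-1-1/ b lt , lq

    Y-avoids-ones : ∀ I → suc ∣ I ∣ ℕ.* 2 ℕ.^ b ℕ.≤ N → ¬ IP^ (∁ I) Unary.U (_∈ˢ Y) (λ _ _ → suc zero)
    Y-avoids-ones I I≤ (x , y , _ , y∈Y , all-one) = clash (zero-outside N m y y∈Y I I<m)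
      where
      I<m : ∣ I ∣ ℕ.< m
      I<m = subst (ℕ._≤ m) (m*n/n≡m (suc ∣ I ∣) u) (/-monoˡ-≤ u I≤)
      clash : ¬ (∃[ i ] i ∈ₛ ∁ I × lookup y i ≡ zeroBlock b)
      clash (i , i∈ , eq) with trans (sym (IP-zeroʳ (lookup x i)))
        (trans (cong (IP (lookup x i)) (sym eq)) (all-one i i∈))
      ... | ()

open import Defs
open import Data.Fin using (zero; suc)
open import Data.Fin.Subset using (Subset; ∣_∣; ∁)
open import Data.Nat using (ℕ; NonZero)
open import Data.Product using (Σ-syntax; _×_; _,_)
open import Data.Vec using (Vec)
open import Relation.Nullary using (¬_)
open import Relation.Unary using (U)

theorem4 : (N b : ℕ) .{{_ : NonZero N}} .{{_ : NonZero b}} (Δ K : ℝ) →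
    fromℕ 1 ≤ cut Δ →
    fromℕ 1 ≤ cut K →
    fromℕ b ≤ log₂ (fromℕ N / (cut K * cut Δ)) →
    Σ[ Y ∈ FinSet⁺ (Vec (Block b) N) ]
    entropyDeficiency Y ≤ cut Δ ×
    (Σ[ τ ∈ ℝ ] IsMinEntropyRate Y τ × fromℕ 1 - fromℕ 1 / fromℕ b < cut τ) ×
    ((I : Subset N) →
    fromℕ ∣ I ∣ ≤ (cut K - fromℕ 1) * cut Δ →
    ¬ IP^ (∁ I) U (_∈ˢ Y) (λ _ _ → suc zero))
theorem4 N b Δ K 1≤Δ 1≤K b≤ =
  Y , (λ q q<def → 1≤Δ q (Y-deficiency q q<def)) ,
  (Y-rate , Y-rate-isMinEntropyRate , 1-1/b<Y-rate) ,
  (λ I ∣I∣≤ → Y-avoids-ones I (Analysis.threshold Δ K 1≤Δ 1≤K N b ∣ I ∣ b≤ ∣I∣≤))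
  where open Analysis.Construction N b
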